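{- Let $\mathbb{F}$ be a field with $\operatorname{char}(\mathbb{F})\neq 2$. Then $\overline{\mathbf{VP}_e}=\{(f_n) \mid \underline{L}_{\mathrm{Fib}}(f_n)\text{ is bounded by a polynomial in } n\}$.
   Context: The generalized Fibonacci polynomial $F_m(x_1,\ldots,x_m)$ is defined by $F_0=1$, $F_1=x_1$, $F_m=x_mF_{m-1}+F_{m-2}$ for $m\geq 2$. Let $\varepsilon$ be a formal variable. A parametrized affine linear form is an affine linear form in $x_1,x_2,\ldots$ with coefficients in $\mathbb{F}(\varepsilon)$. For $f\in\mathbb{F}[x_1,x_2,\ldots]$, the border Fibonacci complexity $\underline{L}_{\mathrm{Fib}}(f)$ is the smallest $m$ such that there exist parametrized affine linear forms $\ell_1(\varepsilon),\ldots,\ell_m(\varepsilon)$ with $F_m(\ell_1(\varepsilon),\ldots,\ell_m(\varepsilon))\in f+\varepsilon\,\mathbb{F}[\varepsilon,x_1,x_2,\ldots]$. $\mathbf{VP}_e(\mathbb{K})$ is the class of families of polynomials over the field $\mathbb{K}$ (in polynomially many variables) with polynomially bounded formula size (fan-in 2 formulas with $+,\times$, leaves variables or constants of $\mathbb{K}$). The approximation closure $\overline{\mathbf{VP}_e}$ (over $\mathbb{F}$) consists of families $(f_n)$ over $\mathbb{F}$ for which there are polynomials $f_{n;i}\in\mathbb{F}[x_1,x_2,\ldots]$ and a function $e:\mathbb{N}\to\mathbb{N}$ such that $g_n=f_n+\varepsilon f_{n;1}+\cdots+\varepsilon^{e(n)}f_{n;e(n)}$ defines a family in $\mathbf{VP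}_e(\mathbb{F}(\varepsilon))$.
   Formalization: The equality is stated for families (f_n) in polynomially many variables, f_n in F[x_1,…,x_{v(n)}] with v polynomially bounded; without this it fails, since f_n = x_1+…+x_{2^n} has border Fibonacci complexity 1 but is not in the closure of VP_e. -}

module Defs where

open import Level using (Level; _⊔_)
open import Algebra.Bundles using (CommutativeRing)
open import Data.Nat as ℕ using (ℕ; zero; suc; _≤_; _<_)
open import Data.Unit using (⊤; tt)
open import Data.Maybe using (Maybe; just; nothing)
open import Data.List using (List; []; _∷_; _++_)
open import Data.Product using (Σ; _×_; _,_; ∃; ∃-syntax; Σ-syntax)
open import Relation.Nullary using (¬_)

record Field (c ℓ : Level) : Set (Level.suc (c ⊔ ℓ)) where
  field
    commutativeRing : CommutativeRing c ℓ
  open CommutativeRing commutativeRing public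
  field
    1≉0     : ¬ (1# ≈ 0#)
    inverse : ∀ x → ¬ (x ≈ 0#) → ∃[ y ] (x * y ≈ 1#)

infixl 6 _⊕_
infixl 7 _⊗_

data Expr {a} (V : Set) (A : Set a) : Set a where
  var : V → Expr V A
  con : A → Expr V A
  _⊕_ : Expr V A → Expr V A → Expr V A
  _⊗_ : Expr V A → Expr V A → Expr V A

size : ∀ {a} {V : Set} {A : Set a} → Expr V A → ℕ
size (var _) = 1
size (con _) = 1
size (e ⊕ e′) = suc (size e ℕ.+ size e′)
size (e ⊗ e′) = suc (size e ℕ.+ size e′)

rename : ∀ {a} {V W : Set} {A : Set a} → (V → W) → Expr V A → Expr W A
rename σ (var v) = var (σ v)
rename σ (con x) = con x
rename σ (e ⊕ e′) = rename σ e ⊕ rename σ e′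
rename σ (e ⊗ e′) = rename σ e ⊗ rename σ e′

AllVars : ∀ {a} {V : Set} {A : Set a} → (V → Set) → Expr V A → Set
AllVars P (var v) = P v
AllVars P (con _) = ⊤
AllVars P (e ⊕ e′) = AllVars P e × AllVars P e′
AllVars P (e ⊗ e′) = AllVars P e × AllVars P e′

-- Polynomial ring R[V] over a commutative ring R: expressions modulo
-- the least congruence containing the commutative-ring axioms and the
-- ring operations on constants (the free commutative R-algebra on V).

module PolyRing {c ℓ} (R : CommutativeRing c ℓ) (V : Set) where
  open CommutativeRing R

  Poly : Set c
  Poly = Expr V Carrier

  infix 4 _~_
  data _~_ : Poly → Poly → Set (c ⊔ ℓ) where
    ~refl  : ∀ {p} → p ~ p
    ~sym   : ∀ {p q} → p ~ q → q ~ p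
    ~trans : ∀ {p q r} → p ~ q → q ~ r → p ~ r
    ~⊕-cong : ∀ {p p′ q q′} → p ~ p′ → q ~ q′ → p ⊕ q ~ p′ ⊕ q′
    ~⊗-cong : ∀ {p p′ q q′} → p ~ p′ → q ~ q′ → p ⊗ q ~ p′ ⊗ q′
    ~⊕-assoc : ∀ p q r → (p ⊕ q) ⊕ r ~ p ⊕ (q ⊕ r)
    ~⊕-comm  : ∀ p q → p ⊕ q ~ q ⊕ p
    ~⊕-idˡ   : ∀ p → con 0# ⊕ p ~ p
    ~⊕-invˡ  : ∀ p → (con (- 1#) ⊗ p) ⊕ p ~ con 0#
    ~⊗-assoc : ∀ p q r → (p ⊗ q) ⊗ r ~ p ⊗ (q ⊗ r)
    ~⊗-comm  : ∀ p q → p ⊗ q ~ q ⊗ p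
    ~⊗-idˡ   : ∀ p → con 1# ⊗ p ~ p
    ~distribˡ : ∀ p q r → p ⊗ (q ⊕ r) ~ (p ⊗ q) ⊕ (p ⊗ r)
    ~con-cong : ∀ {x y} → x ≈ y → con x ~ con y
    ~con-+    : ∀ x y → con x ⊕ con y ~ con (x + y)
    ~con-*    : ∀ x y → con x ⊗ con y ~ con (x * y)

PolyBounded : (ℕ → ℕ) → Set
PolyBounded s = ∃[ k ] (∀ n → s n ≤ k ℕ.* n ℕ.^ k ℕ.+ k)

module _ {c ℓ} (𝔽 : Field c ℓ) where
  open Field 𝔽

  -- 𝔽[ε]  (the single variable tt is ε)
  open PolyRing commutativeRing ⊤ public
    using () renaming (Poly to Polyε; _~_ to _~ε_)
  -- 𝔽[x₀,x₁,…]  (variable i is the (i+1)-st variable x_{i+1})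
  open PolyRing commutativeRing ℕ public
    using () renaming (Poly to PolyX; _~_ to _~x_)
  -- 𝔽[ε,x₀,x₁,…]  (nothing = ε, just i = x_i)
  open PolyRing commutativeRing (Maybe ℕ) public
    using () renaming (Poly to PolyεX; _~_ to _~εx_)

  NonZeroε : Set (c ⊔ ℓ)
  NonZeroε = Σ Polyε (λ q → ¬ (q ~ε con 0#))

  -- Elements of 𝔽(ε): a numerator in 𝔽[ε] over a denominator given as
  -- a (formal) product of nonzero elements of 𝔽[ε].
  Fracε : Set (c ⊔ ℓ)
  Fracε = Polyε × List NonZeroε

  -- Elements of 𝔽(ε)[x]: numerator in 𝔽[ε,x], denominator as above.
  RatX : Set (c ⊔ ℓ)
  RatX = PolyεX × List NonZeroε

  ε-var : PolyεX
  ε-var = var nothing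

  embedε : Polyε → PolyεX
  embedε = rename (λ _ → nothing)

  embedX : PolyX → PolyεX
  embedX = rename just

  denom : List NonZeroε → PolyεX
  denom [] = con 1#
  denom ((q , _) ∷ ds) = embedε q ⊗ denom ds

  infix 4 _≋_
  _≋_ : RatX → RatX → Set (c ⊔ ℓ)
  (h , ds) ≋ (h′ , ds′) = (h ⊗ denom ds′) ~εx (h′ ⊗ denom ds)

  ⟦_⟧ : Expr ℕ Fracε → RatX
  ⟦ var i ⟧ = var (just i) , []
  ⟦ con (p , ds) ⟧ = embedε p , ds
  ⟦ φ ⊕ ψ ⟧ with ⟦ φ ⟧ | ⟦ ψ ⟧
  ... | h , ds | h′ , ds′ = (h ⊗ denom ds′ ⊕ h′ ⊗ denom ds) , ds ++ ds′
  ⟦ φ ⊗ ψ ⟧ with ⟦ φ ⟧ | ⟦ ψ ⟧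
  ... | h , ds | h′ , ds′ = h ⊗ h′ , ds ++ ds′

  fracConst : Carrier → Fracε
  fracConst a = con a , []

  -- F_m(ℓ₁,…,ℓ_m) as a formula; ℓ k is the k-th argument (k ≥ 1)
  fib : ∀ {a} {V : Set} {A : Set a} → A → (ℕ → Expr V A) → ℕ → Expr V A
  fib one ℓs zero = con one
  fib one ℓs (suc zero) = ℓs 1
  fib one ℓs (suc (suc m)) =
    ℓs (suc (suc m)) ⊗ fib one ℓs (suc m) ⊕ fib one ℓs m

  record Affine : Set (c ⊔ ℓ) where
    constructor affine
    field
      const  : Fracε
      coeffs : List Fracε

  affineFrom : ℕ → List Fracε → Expr ℕ Fracε
  affineFrom j [] = con (fracConst 0#)
  affineFrom j (a ∷ as) = con a ⊗ var j ⊕ affineFrom (suc j) as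

  affineExpr : Affine → Expr ℕ Fracε
  affineExpr (affine c₀ cs) = con c₀ ⊕ affineFrom 0 cs

  FibApprox : PolyX → ℕ → Set (c ⊔ ℓ)
  FibApprox f m =
    Σ[ ℓs ∈ (ℕ → Affine) ] Σ[ g ∈ PolyεX ]
      (⟦ fib (fracConst 1#) (λ k → affineExpr (ℓs k)) m ⟧
         ≋ (embedX f ⊕ ε-var ⊗ g , []))

  BorderFibAtMost : PolyX → ℕ → Set (c ⊔ ℓ)
  BorderFibAtMost f b = Σ[ m ∈ ℕ ] (m ≤ b × FibApprox f m)

  PolyManyVars : (ℕ → PolyX) → Set (c ⊔ ℓ)
  PolyManyVars f = Σ[ v ∈ (ℕ → ℕ) ] (PolyBounded v ×
    (∀ n → Σ[ h ∈ PolyX ] (h ~x f n × AllVars (λ i → i < v n) h)))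

  PolyManyVarsRat : (ℕ → RatX) → Set (c ⊔ ℓ)
  PolyManyVarsRat g = Σ[ v ∈ (ℕ → ℕ) ] (PolyBounded v ×
    (∀ n → Σ[ r ∈ RatX ] (r ≋ g n ×
       AllVars (λ { nothing → ⊤ ; (just i) → i < v n }) (Data.Product.proj₁ r))))

  InVPeε : (ℕ → RatX) → Set (c ⊔ ℓ)
  InVPeε g = PolyManyVarsRat g ×
    Σ[ φ ∈ (ℕ → Expr ℕ Fracε) ] (PolyBounded (λ n → size (φ n)) × (∀ n → ⟦ φ n ⟧ ≋ g n))

  εpow : ℕ → PolyεX
  εpow zero = con 1#
  εpow (suc i) = ε-var ⊗ εpow i

  εsum : (ℕ → PolyX) → ℕ → PolyεX
  εsum fs zero = con 0#
  εsum fs (suc e) = εsum fs e ⊕ εpow (suc e) ⊗ embedX (fs (suc e))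

  InVPeClosure : (ℕ → PolyX) → Set (c ⊔ ℓ)
  InVPeClosure f = Σ[ e ∈ (ℕ → ℕ) ] Σ[ fs ∈ (ℕ → ℕ → PolyX) ]
    InVPeε (λ n → (embedX (f n) ⊕ εsum (fs n) (e n)) , [])

  PolyBorderFib : (ℕ → PolyX) → Set (c ⊔ ℓ)
  PolyBorderFib f = Σ[ p ∈ (ℕ → ℕ) ] (PolyBounded p × (∀ n → BorderFibAtMost (f n) (p n)))

ℕ-family : ∀ {c ℓ} → Field c ℓ → Set c
ℕ-family 𝔽 = ℕ → PolyX 𝔽

{-# OPTIONS --safe #-}
module Submission where

-- Write Q(x) = [[x , 1] , [1 , 0]]; then F_m(x₁,…,x_m) is the upper left entry of Q(x_m) ⋯ Q(x₁), and
-- Q(f) Q(0) = [[1 , f] , [0 , 1]] =: E(f), so E(f) E(g) = E(f + g). For a small π the commutator of E(f)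
-- with the lower triangular matrix with entry cπ², conjugated by diag(1/π , π), is E(-cf²) + O(π); with
-- fg = ((f+g)² - (f-g)²)/4 products of formulas are approximated too, every level of the formula costing a
-- constant factor in length. After rebalancing the formula to logarithmic depth (Brent) the length is
-- polynomial. Over 𝔽(ε) one first clears denominators, f + O(ε) = h / d, and takes π = ε d at the root, so
-- that the error, still divisible by ε after dividing by d, is polynomial. Conversely, set the variables
-- not occurring in f to zero and evaluate the product of the m matrices along a balanced tree.
-- Equality in 𝔽 is neither decidable nor stable, so 𝔽[ε,x] cannot be shown to be an integral domain;
-- hence fractions are never cancelled, and all common factors are tracked explicitly.

open import Defs
import Level
open import Algebra.Bundles using (CommutativeRing; RawRing)
import Algebra.Properties.AbelianGroup
import Algebra.Properties.Ring
import Algebra.Properties.Semiring.Mult.TCOptimised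
import Algebra.Solver.Ring
import Algebra.Solver.Ring.AlmostCommutativeRing as ACR
import Data.Integer as ℤ
import Data.Integer.Properties as ℤₚ
open import Data.List using (List; []; _∷_; _++_; length; map; take; drop)
import Data.List.Properties as Listₚ
open import Data.List.Relation.Unary.All using (All; []; _∷_)
import Data.List.Relation.Unary.All.Properties as Allₚ
open import Data.Maybe using (Maybe; just; nothing)
open import Data.Nat as ℕ using (ℕ; zero; suc; s≤s; z≤n)
import Data.Nat.Properties as ℕₚ
import Data.Nat.Solver
open import Data.Product using (_×_; _,_; ∃-syntax; Σ-syntax; proj₁; proj₂)
import Data.Sign as Sign
open import Data.Unit using (tt)
import Relation.Binary.PropositionalEquality as ≡
import Relation.Binary.Reasoning.Setoid
open import Relation.Nullary using (¬_; yes; no; contradiction)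
open ≡ using (_≡_)
open Data.Nat.Solver.+-*-Solver using () renaming (solve to ℕsolve; _:=_ to _≔_; _:+_ to _⊞_; _:*_ to _⊡_; con to kon)

-- The error terms dictate the form of the induction. The useful entry of the commutator has order
-- π², and normalising it divides the error by π² as well; so a product at precision π needs its
-- factors at precision π³. The inductive claim is therefore made for all π at once. Since π enters
-- a word only through scalars in its letters, cubing it at every level adds no length. The claim
-- also carries f and -f together, because the commutator consumes both E(f) and E(-f). Addition is
-- mere concatenation, so only products need the commutator; Brent's decomposition A ν + B uses both
-- operations a bounded number of times per level. An element of 𝔽(ε) is a single leaf of a formula,
-- whatever its degree. This makes it affordable to clear denominators and to carry the uncancelled
-- factors: each is multiplied into one constant.

module IntegerCoefficients {c ℓ} (R : CommutativeRing c ℓ) where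
  open CommutativeRing R
  open Algebra.Properties.Ring ring using (-‿distribˡ-*; -‿distribʳ-*; -0#≈0#; -‿involutive)
  open Algebra.Properties.AbelianGroup +-abelianGroup using (⁻¹-∙-comm)
  open Algebra.Properties.Semiring.Mult.TCOptimised semiring renaming (_×_ to _·_)
  open Relation.Binary.Reasoning.Setoid setoid

  -- The ring solver has to compare coefficients, and equality in the ring is not assumed decidable;
  -- so integers are compared and mapped in. With this version of `_·_` the term `1 · 1#` reduces to
  -- `1#`, so `:0` and `:1` denote exactly `0#` and `1#`.
  fromℤ : ℤ.ℤ → Carrier
  fromℤ (ℤ.+ n) = n · 1#
  fromℤ ℤ.-[1+ n ] = - (suc n · 1#)

  private
    cancel-1 : ∀ x y → (1# + x) - (1# + y) ≈ x - y
    cancel-1 x y = begin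
      (1# + x) - (1# + y)       ≈⟨ +-congˡ (⁻¹-∙-comm 1# y) ⟨
      (1# + x) + (- 1# + - y)   ≈⟨ +-congʳ (+-comm 1# x) ⟩
      (x + 1#) + (- 1# + - y)   ≈⟨ +-assoc x 1# _ ⟩
      x + (1# + (- 1# + - y))   ≈⟨ +-congˡ (+-assoc 1# _ _) ⟨
      x + ((1# - 1#) + - y)     ≈⟨ +-congˡ (+-congʳ (-‿inverseʳ 1#)) ⟩
      x + (0# + - y)            ≈⟨ +-congˡ (+-identityˡ _) ⟩
      x - y                     ∎

  fromℤ-⊖ : ∀ m n → fromℤ (m ℤ.⊖ n) ≈ m · 1# - n · 1#
  fromℤ-⊖ zero zero = sym (-‿inverseʳ 0#)
  fromℤ-⊖ zero (suc n) = sym (+-identityˡ _)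
  fromℤ-⊖ (suc m) zero = sym (trans (+-congˡ -0#≈0#) (+-identityʳ _))
  fromℤ-⊖ (suc m) (suc n) = begin
    fromℤ (suc m ℤ.⊖ suc n)                ≡⟨ ≡.cong fromℤ (ℤₚ.[1+m]⊖[1+n]≡m⊖n m n) ⟩
    fromℤ (m ℤ.⊖ n)                        ≈⟨ fromℤ-⊖ m n ⟩
    m · 1# - n · 1#                        ≈⟨ cancel-1 _ _ ⟨
    (1# + m · 1#) - (1# + n · 1#)          ≈⟨ +-cong (1+× m 1#) (-‿cong (1+× n 1#)) ⟨
    suc m · 1# - suc n · 1#                ∎

  fromℤ-+ : ∀ i j → fromℤ (i ℤ.+ j) ≈ fromℤ i + fromℤ j
  fromℤ-+ (ℤ.+ m) (ℤ.+ n) = ×-homo-+ 1# m n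
  fromℤ-+ (ℤ.+ m) ℤ.-[1+ n ] = fromℤ-⊖ m (suc n)
  fromℤ-+ ℤ.-[1+ m ] (ℤ.+ n) = trans (fromℤ-⊖ n (suc m)) (+-comm _ _)
  fromℤ-+ ℤ.-[1+ m ] ℤ.-[1+ n ] = begin
    - (suc (suc (m ℕ.+ n)) · 1#)           ≡⟨ ≡.cong (λ k → - (suc k · 1#)) (≡.sym (ℕₚ.+-suc m n)) ⟩
    - ((suc m ℕ.+ suc n) · 1#)             ≈⟨ -‿cong (×-homo-+ 1# (suc m) (suc n)) ⟩
    - (suc m · 1# + suc n · 1#)            ≈⟨ ⁻¹-∙-comm _ _ ⟨
    - (suc m · 1#) - suc n · 1#            ∎

  fromℤ-neg : ∀ i → fromℤ (ℤ.- i) ≈ - fromℤ i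
  fromℤ-neg (ℤ.+ zero) = sym -0#≈0#
  fromℤ-neg (ℤ.+ suc n) = refl
  fromℤ-neg ℤ.-[1+ n ] = sym (-‿involutive _)

  fromℤ-* : ∀ i j → fromℤ (i ℤ.* j) ≈ fromℤ i * fromℤ j
  fromℤ-* (ℤ.+ m) (ℤ.+ n) = trans (reflexive (≡.cong fromℤ (≡.sym (ℤₚ.pos-* m n)))) (×1-homo-* m n)
  fromℤ-* (ℤ.+ m) ℤ.-[1+ n ] = begin
    fromℤ (Sign.- ℤ.◃ (m ℕ.* suc n))       ≡⟨ ≡.cong fromℤ (ℤₚ.-◃n≡-n (m ℕ.* suc n)) ⟩
    fromℤ (ℤ.- (ℤ.+ (m ℕ.* suc n)))        ≈⟨ fromℤ-neg (ℤ.+ (m ℕ.* suc n)) ⟩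
    - ((m ℕ.* suc n) · 1#)                 ≈⟨ -‿cong (×1-homo-* m (suc n)) ⟩
    - (m · 1# * (suc n · 1#))              ≈⟨ -‿distribʳ-* _ _ ⟩
    m · 1# * - (suc n · 1#)                ∎
  fromℤ-* ℤ.-[1+ m ] (ℤ.+ n) = begin
    fromℤ (Sign.- ℤ.◃ (suc m ℕ.* n))       ≡⟨ ≡.cong fromℤ (ℤₚ.-◃n≡-n (suc m ℕ.* n)) ⟩
    fromℤ (ℤ.- (ℤ.+ (suc m ℕ.* n)))        ≈⟨ fromℤ-neg (ℤ.+ (suc m ℕ.* n)) ⟩
    - ((suc m ℕ.* n) · 1#)                 ≈⟨ -‿cong (×1-homo-* (suc m) n) ⟩
    - (suc m · 1# * (n · 1#))              ≈⟨ -‿distribˡ-* _ _ ⟩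
    - (suc m · 1#) * (n · 1#)              ∎
  fromℤ-* ℤ.-[1+ m ] ℤ.-[1+ n ] = begin
    (suc m ℕ.* suc n) · 1#                 ≈⟨ ×1-homo-* (suc m) (suc n) ⟩
    suc m · 1# * (suc n · 1#)              ≈⟨ -‿involutive _ ⟨
    - - (suc m · 1# * (suc n · 1#))        ≈⟨ -‿cong (-‿distribˡ-* _ _) ⟩
    - (- (suc m · 1#) * (suc n · 1#))      ≈⟨ -‿distribʳ-* _ _ ⟩
    - (suc m · 1#) * - (suc n · 1#)        ∎

  ℤ-rawRing : RawRing _ _
  ℤ-rawRing = record
    { Carrier = ℤ.ℤ ; _≈_ = _≡_ ; _+_ = ℤ._+_ ; _*_ = ℤ._*_ ; -_ = ℤ.-_ ; 0# = ℤ.0ℤ ; 1# = ℤ.1ℤ }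

  fromℤ-homomorphism : ℤ-rawRing ACR.-Raw-AlmostCommutative⟶ ACR.fromCommutativeRing R
  fromℤ-homomorphism = record
    { ⟦_⟧ = fromℤ ; +-homo = fromℤ-+ ; *-homo = fromℤ-* ; -‿homo = fromℤ-neg
    ; 0-homo = refl ; 1-homo = refl }

  fromℤ-≟ : ∀ i j → Maybe (fromℤ i ≈ fromℤ j)
  fromℤ-≟ i j with i ℤ.≟ j
  ... | yes i≡j = just (reflexive (≡.cong fromℤ i≡j))
  ... | no  _   = nothing

  open Algebra.Solver.Ring ℤ-rawRing (ACR.fromCommutativeRing R) fromℤ-homomorphism fromℤ-≟ public
    using (Polynomial; solve; _:=_; _:+_; _:*_; :-_)
  open Algebra.Solver.Ring ℤ-rawRing (ACR.fromCommutativeRing R) fromℤ-homomorphism fromℤ-≟ using (con)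

  :0 :1 : ∀ {n} → Polynomial n
  :0 = con ℤ.0ℤ
  :1 = con ℤ.1ℤ

-- Two-by-two matrices and words of continuant letters

record Mat {a} (A : Set a) : Set a where
  constructor mat
  field m₁₁ m₁₂ m₂₁ m₂₂ : A
open Mat public

-- The word (L₁ , l₁) ∷ … ∷ (Lₘ , lₘ) stands for the continuant with arguments Lᵢ / lᵢ:
-- ⟪ w ⟫ is the product of the matrices [[Lᵢ/lᵢ , 1] , [1 , 0]] multiplied by scale w = l₁ ⋯ lₘ,
-- which clears the denominators without inverting them.
module WordMatrices {a} {A : Set a} (_+_ _*_ : A → A → A) (-_ : A → A) (0# 1# : A) where
  infixr 7 _∙_
  _∙_ : Mat A → Mat A → Mat A
  mat a b c d ∙ mat a′ b′ c′ d′ =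
    mat ((a * a′) + (b * c′)) ((a * b′) + (b * d′)) ((c * a′) + (d * c′)) ((c * b′) + (d * d′))

  𝟙 : Mat A
  𝟙 = mat 1# 0# 0# 1#

  Word : Set a
  Word = List (A × A)

  letter : A × A → Mat A
  letter (x , l) = mat x l l 0#

  scale : Word → A
  scale [] = 1#
  scale ((x , l) ∷ w) = l * scale w

  ⟪_⟫ : Word → Mat A
  ⟪ [] ⟫ = 𝟙
  ⟪ x ∷ w ⟫ = letter x ∙ ⟪ w ⟫

  upper lower : A → Mat A
  upper f = mat 1# f 0# 1#
  lower f = mat 1# 0# f 1#

  upperWord lowerWord : A → Word
  upperWord f = (f , 1#) ∷ (0# , 1#) ∷ []
  lowerWord f = (0# , 1#) ∷ (f , 1#) ∷ []

  -- With t = a / b and w(t) = upper(t) lower(-1/t) upper(t), this is w(t) w(-1) = diag(t , 1/t).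
  diagWord : A → A → Word
  diagWord a b = (a , b) ∷ ((- b) , a) ∷ (a , b) ∷ (0# , 1#) ∷ ((- 1#) , 1#) ∷ (1# , 1#) ∷ ((- 1#) , 1#) ∷ (0# , 1#) ∷ []

  commutator : A → A → Mat A
  commutator f b = upper f ∙ lower b ∙ upper (- f) ∙ lower (- b)

-- Matrix identities and approximation modulo π

module FibonacciMatrices {c ℓ} (R : CommutativeRing c ℓ) where
  open CommutativeRing R
  open IntegerCoefficients R
  open Relation.Binary.Reasoning.Setoid setoid

  open WordMatrices _+_ _*_ -_ 0# 1# public
  -- The same matrices and words over solver syntax: interpreting a symbolic entry gives back the
  -- entry over the ring, so identities between long products can be passed to `solve` without being
  -- expanded by hand.
  module Symbolic {n : ℕ} = WordMatrices {A = Polynomial n} _:+_ _:*_ :-_ :0 :1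

  infix 4 _≈ᴹ_
  record _≈ᴹ_ (X Y : Mat Carrier) : Set ℓ where
    constructor eqᴹ
    field
      ≈₁₁ : m₁₁ X ≈ m₁₁ Y
      ≈₁₂ : m₁₂ X ≈ m₁₂ Y
      ≈₂₁ : m₂₁ X ≈ m₂₁ Y
      ≈₂₂ : m₂₂ X ≈ m₂₂ Y
  open _≈ᴹ_ public

  refl-M : ∀ {X} → X ≈ᴹ X
  refl-M = eqᴹ refl refl refl refl

  sym-M : ∀ {X Y} → X ≈ᴹ Y → Y ≈ᴹ X
  sym-M (eqᴹ p q r s) = eqᴹ (sym p) (sym q) (sym r) (sym s)

  trans-M : ∀ {X Y Z} → X ≈ᴹ Y → Y ≈ᴹ Z → X ≈ᴹ Z
  trans-M (eqᴹ p q r s) (eqᴹ p′ q′ r′ s′) = eqᴹ (trans p p′) (trans q q′) (trans r r′) (trans s s′)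

  ∙-cong : ∀ {X X′ Y Y′} → X ≈ᴹ X′ → Y ≈ᴹ Y′ → X ∙ Y ≈ᴹ X′ ∙ Y′
  ∙-cong (eqᴹ p q r s) (eqᴹ p′ q′ r′ s′) = eqᴹ
    (+-cong (*-cong p p′) (*-cong q r′)) (+-cong (*-cong p q′) (*-cong q s′))
    (+-cong (*-cong r p′) (*-cong s r′)) (+-cong (*-cong r q′) (*-cong s s′))

  ∙-identityˡ : ∀ X → 𝟙 ∙ X ≈ᴹ X
  ∙-identityˡ (mat a b c d) = eqᴹ (l a c) (l b d) (r a c) (r b d)
    where
    l : ∀ x y → 1# * x + 0# * y ≈ x
    l = solve 2 (λ x y → :1 :* x :+ :0 :* y := x) refl
    r : ∀ x y → 0# * x + 1# * y ≈ y
    r = solve 2 (λ x y → :0 :* x :+ :1 :* y := y) refl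

  ∙-assoc : ∀ X Y Z → (X ∙ Y) ∙ Z ≈ᴹ X ∙ (Y ∙ Z)
  ∙-assoc (mat a b c d) (mat e f g h) (mat i j k l) =
    eqᴹ (entry a b i k) (entry a b j l) (entry c d i k) (entry c d j l)
    where
    entry : ∀ a b i k → (a * e + b * g) * i + (a * f + b * h) * k ≈ a * (e * i + f * k) + b * (g * i + h * k)
    entry a b i k = solve 8 (λ a b e f g h i k →
      (a :* e :+ b :* g) :* i :+ (a :* f :+ b :* h) :* k := a :* (e :* i :+ f :* k) :+ b :* (g :* i :+ h :* k))
      refl a b e f g h i k

  ⟪⟫-++ : ∀ w w′ → ⟪ w ++ w′ ⟫ ≈ᴹ ⟪ w ⟫ ∙ ⟪ w′ ⟫
  ⟪⟫-++ [] w′ = sym-M (∙-identityˡ _)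
  ⟪⟫-++ (x ∷ w) w′ = trans-M (∙-cong refl-M (⟪⟫-++ w w′)) (sym-M (∙-assoc (letter x) ⟪ w ⟫ ⟪ w′ ⟫))

  scale-++ : ∀ w w′ → scale (w ++ w′) ≈ scale w * scale w′
  scale-++ [] w′ = sym (*-identityˡ _)
  scale-++ ((x , l) ∷ w) w′ = trans (*-congˡ (scale-++ w w′)) (sym (*-assoc l _ _))

  -- x / s ≡ e modulo π.
  Near : (s π x e : Carrier) → Set (c Level.⊔ ℓ)
  Near s π x e = ∃[ k ] (x ≈ s * (e + π * k))

  near-exact : ∀ {s π x e} → x ≈ s * e → Near s π x e
  near-exact {s} {π} {x} {e} p = 0# , trans p
    (solve 3 (λ s π e → s :* e := s :* (e :+ π :* :0)) refl s π e)

  near-resp : ∀ {s s′ π π′ x x′ e e′} → s ≈ s′ → π ≈ π′ → x ≈ x′ → e ≈ e′ → Near s π x e → Near s′ π′ x′ e′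
  near-resp p q r t (k , h) = k , trans (sym r) (trans h (*-cong p (+-cong t (*-congʳ q))))

  near-+ : ∀ {s π x y e f} → Near s π x e → Near s π y f → Near s π (x + y) (e + f)
  near-+ {s} {π} {x} {y} {e} {f} (k , p) (l , q) = k + l , trans (+-cong p q)
    (solve 6 (λ s π e f k l → s :* (e :+ π :* k) :+ s :* (f :+ π :* l) := s :* ((e :+ f) :+ π :* (k :+ l)))
      refl s π e f k l)

  near-* : ∀ {s t π x y e f} → Near s π x e → Near t π y f → Near (s * t) π (x * y) (e * f)
  near-* {s} {t} {π} {x} {y} {e} {f} (k , p) (l , q) = e * l + k * f + π * k * l , trans (*-cong p q)
    (solve 7 (λ s t π e f k l → (s :* (e :+ π :* k)) :* (t :* (f :+ π :* l))
        := (s :* t) :* (e :* f :+ π :* (e :* l :+ k :* f :+ π :* k :* l)))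
      refl s t π e f k l)

  record Nearᴹ (s π : Carrier) (X E : Mat Carrier) : Set (c Level.⊔ ℓ) where
    constructor nearᴹ
    field
      near₁₁ : Near s π (m₁₁ X) (m₁₁ E)
      near₁₂ : Near s π (m₁₂ X) (m₁₂ E)
      near₂₁ : Near s π (m₂₁ X) (m₂₁ E)
      near₂₂ : Near s π (m₂₂ X) (m₂₂ E)
  open Nearᴹ public

  nearᴹ-resp : ∀ {s s′ π π′ X X′ E E′} → s ≈ s′ → π ≈ π′ → X ≈ᴹ X′ → E ≈ᴹ E′ → Nearᴹ s π X E → Nearᴹ s′ π′ X′ E′
  nearᴹ-resp p q (eqᴹ a b c d) (eqᴹ a′ b′ c′ d′) (nearᴹ h i j k) =
    nearᴹ (near-resp p q a a′ h) (near-resp p q b b′ i) (near-resp p q c c′ j) (near-resp p q d d′ k)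

  nearᴹ-∙ : ∀ {s t π X Y E F} → Nearᴹ s π X E → Nearᴹ t π Y F → Nearᴹ (s * t) π (X ∙ Y) (E ∙ F)
  nearᴹ-∙ (nearᴹ a b c d) (nearᴹ a′ b′ c′ d′) = nearᴹ
    (near-+ (near-* a a′) (near-* b c′)) (near-+ (near-* a b′) (near-* b d′))
    (near-+ (near-* c a′) (near-* d c′)) (near-+ (near-* c b′) (near-* d d′))

  Approximates : Word → Carrier → Mat Carrier → Set (c Level.⊔ ℓ)
  Approximates w π E = Nearᴹ (scale w) π ⟪ w ⟫ E

  approx-++ : ∀ {π} w w′ E F → Approximates w π E → Approximates w′ π F → Approximates (w ++ w′) π (E ∙ F)
  approx-++ w w′ E F p q = nearᴹ-resp (sym (scale-++ w w′)) refl (sym-M (⟪⟫-++ w w′)) refl-M (nearᴹ-∙ p q)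

  approx-resp : ∀ {π E F} w → E ≈ᴹ F → Approximates w π E → Approximates w π F
  approx-resp w = nearᴹ-resp refl refl refl-M

  upper-cong : ∀ {f g} → f ≈ g → upper f ≈ᴹ upper g
  upper-cong p = eqᴹ refl p refl refl

  upper-+ : ∀ f g → upper f ∙ upper g ≈ᴹ upper (f + g)
  upper-+ f g = eqᴹ
    (solve 2 (λ f g → m₁₁ (Symbolic.upper f Symbolic.∙ Symbolic.upper g) := :1) refl f g)
    (solve 2 (λ f g → m₁₂ (Symbolic.upper f Symbolic.∙ Symbolic.upper g) := f :+ g) refl f g)
    (solve 2 (λ f g → m₂₁ (Symbolic.upper f Symbolic.∙ Symbolic.upper g) := :0) refl f g)
    (solve 2 (λ f g → m₂₂ (Symbolic.upper f Symbolic.∙ Symbolic.upper g) := :1) refl f g)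

  approx-upper : ∀ {π} f → Approximates (upperWord f) π (upper f)
  approx-upper f = nearᴹ
    (near-exact (solve 1 (λ f → m₁₁ S.⟪ S.upperWord f ⟫ := S.scale (S.upperWord f) :* :1) refl f))
    (near-exact (solve 1 (λ f → m₁₂ S.⟪ S.upperWord f ⟫ := S.scale (S.upperWord f) :* f) refl f))
    (near-exact (solve 1 (λ f → m₂₁ S.⟪ S.upperWord f ⟫ := S.scale (S.upperWord f) :* :0) refl f))
    (near-exact (solve 1 (λ f → m₂₂ S.⟪ S.upperWord f ⟫ := S.scale (S.upperWord f) :* :1) refl f))
    where module S = Symbolic

  approx-lower : ∀ {π} f → Approximates (lowerWord f) π (lower f)
  approx-lower f = nearᴹ
    (near-exact (solve 1 (λ f → m₁₁ S.⟪ S.lowerWord f ⟫ := S.scale (S.lowerWord f) :* :1) refl f))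
    (near-exact (solve 1 (λ f → m₁₂ S.⟪ S.lowerWord f ⟫ := S.scale (S.lowerWord f) :* :0) refl f))
    (near-exact (solve 1 (λ f → m₂₁ S.⟪ S.lowerWord f ⟫ := S.scale (S.lowerWord f) :* f) refl f))
    (near-exact (solve 1 (λ f → m₂₂ S.⟪ S.lowerWord f ⟫ := S.scale (S.lowerWord f) :* :1) refl f))
    where module S = Symbolic

  scale-diagWord : ∀ a b → scale (diagWord a b) ≈ a * b * b
  scale-diagWord = solve 2 (λ a b → Symbolic.scale (Symbolic.diagWord a b) := a :* b :* b) refl

  -- Divided by the scale `a * b * b`, the right-hand side is diag(a/b , b/a).
  ⟪diagWord⟫ : ∀ a b → ⟪ diagWord a b ⟫ ≈ᴹ mat (a * a * b) 0# 0# (b * b * b)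
  ⟪diagWord⟫ a b = eqᴹ
    (solve 2 (λ a b → m₁₁ Symbolic.⟪ Symbolic.diagWord a b ⟫ := a :* a :* b) refl a b)
    (solve 2 (λ a b → m₁₂ Symbolic.⟪ Symbolic.diagWord a b ⟫ := :0) refl a b)
    (solve 2 (λ a b → m₂₁ Symbolic.⟪ Symbolic.diagWord a b ⟫ := :0) refl a b)
    (solve 2 (λ a b → m₂₂ Symbolic.⟪ Symbolic.diagWord a b ⟫ := b :* b :* b) refl a b)

  diag-∙-diag : ∀ a d a′ d′ X → mat a 0# 0# d ∙ X ∙ mat a′ 0# 0# d′ ≈ᴹ
    mat (a * m₁₁ X * a′) (a * m₁₂ X * d′) (d * m₂₁ X * a′) (d * m₂₂ X * d′)
  diag-∙-diag a d a′ d′ (mat x y z w) = eqᴹ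
    (solve 6 (λ a a′ x y z w → a :* (x :* a′ :+ y :* :0) :+ :0 :* (z :* a′ :+ w :* :0) := a :* x :* a′) refl a a′ x y z w)
    (solve 6 (λ a d′ x y z w → a :* (x :* :0 :+ y :* d′) :+ :0 :* (z :* :0 :+ w :* d′) := a :* y :* d′) refl a d′ x y z w)
    (solve 6 (λ d a′ x y z w → :0 :* (x :* a′ :+ y :* :0) :+ d :* (z :* a′ :+ w :* :0) := d :* z :* a′) refl d a′ x y z w)
    (solve 6 (λ d d′ x y z w → :0 :* (x :* :0 :+ y :* d′) :+ d :* (z :* :0 :+ w :* d′) := d :* w :* d′) refl d d′ x y z w)

  -- To first order in `b`, the upper right entry is the only one quadratic in `f`; this is where
  -- the square comes from.
  commutator-entries : ∀ f b → commutator f b ≈ᴹ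
    mat (1# + f * b + f * f * (b * b)) (- (f * f * b)) (f * (b * b)) (1# - f * b)
  commutator-entries f b = eqᴹ
    (solve 2 (λ f b → m₁₁ (Symbolic.commutator f b) := :1 :+ f :* b :+ f :* f :* (b :* b)) refl f b)
    (solve 2 (λ f b → m₁₂ (Symbolic.commutator f b) := :- (f :* f :* b)) refl f b)
    (solve 2 (λ f b → m₂₁ (Symbolic.commutator f b) := f :* (b :* b)) refl f b)
    (solve 2 (λ f b → m₂₂ (Symbolic.commutator f b) := :1 :+ :- (f :* b)) refl f b)

  -- At precision π³ the commutator is known well enough to survive the conjugation by diag(1/π , π),
  -- which divides its upper right entry -cπ²f² by π² and makes its other deviations from 1 divisible by π.
  conjugated-commutator : ∀ {s π X} c f → Nearᴹ s (π * (π * π)) X (commutator f (c * (π * π))) →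
    Nearᴹ ((1# * π * π) * (s * (π * 1# * 1#))) π
      (mat (1# * 1# * π) 0# 0# (π * π * π) ∙ X ∙ mat (π * π * 1#) 0# 0# (1# * 1# * 1#))
      (upper (- (c * (f * f))))
  conjugated-commutator {s} {π} {X} c f near =
    nearᴹ-resp refl refl (sym-M (diag-∙-diag _ _ _ _ X)) refl-M (nearᴹ (entry₁₁ (near₁₁ near′)) (entry₁₂ (near₁₂ near′)) (entry₂₁ (near₂₁ near′)) (entry₂₂ (near₂₂ near′)))
    where
    near′ = nearᴹ-resp refl refl refl-M (commutator-entries f (c * (π * π))) near
    b = c * (π * π)
    -- The scales of `diagWord 1# π`, of the word in the middle and of `diagWord π 1#`, in the form
    -- given by `scale-diagWord`; altogether s π³.
    total = (1# * π * π) * (s * (π * 1# * 1#))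
    :total : ∀ {n} → (s π : Polynomial n) → Polynomial n
    :total s π = (:1 :* π :* π) :* (s :* (π :* :1 :* :1))
    entry₁₁ : ∀ {x} → Near s (π * (π * π)) x (1# + f * b + f * f * (b * b)) →
      Near total π ((1# * 1# * π) * x * (π * π * 1#)) 1#
    entry₁₁ (k , p) = f * (c * π) + f * f * (c * π * (c * (π * π))) + π * π * k , trans (*-congʳ (*-congˡ p))
      (solve 5 (λ s π c f k → (:1 :* :1 :* π) :* (s :* ((:1 :+ f :* (c :* (π :* π)) :+ f :* f :* (c :* (π :* π) :* (c :* (π :* π)))) :+ π :* (π :* π) :* k)) :* (π :* π :* :1)
        := :total s π :* (:1 :+ π :* (f :* (c :* π) :+ f :* f :* (c :* π :* (c :* (π :* π))) :+ π :* π :* k))) refl s π c f k)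
    entry₁₂ : ∀ {x} → Near s (π * (π * π)) x (- (f * f * b)) →
      Near total π ((1# * 1# * π) * x * (1# * 1# * 1#)) (- (c * (f * f)))
    entry₁₂ (k , p) = k , trans (*-congʳ (*-congˡ p))
      (solve 5 (λ s π c f k → (:1 :* :1 :* π) :* (s :* (:- (f :* f :* (c :* (π :* π))) :+ π :* (π :* π) :* k)) :* (:1 :* :1 :* :1)
        := :total s π :* (:- (c :* (f :* f)) :+ π :* k)) refl s π c f k)
    entry₂₁ : ∀ {x} → Near s (π * (π * π)) x (f * (b * b)) →
      Near total π ((π * π * π) * x * (π * π * 1#)) 0#
    entry₂₁ (k , p) = π * (f * (b * b) + π * (π * π) * k) , trans (*-congʳ (*-congˡ p))
      (solve 5 (λ s π f b k → (π :* π :* π) :* (s :* (f :* (b :* b) :+ π :* (π :* π) :* k)) :* (π :* π :* :1)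
        := :total s π :* (:0 :+ π :* (π :* (f :* (b :* b) :+ π :* (π :* π) :* k)))) refl s π f b k)
    entry₂₂ : ∀ {x} → Near s (π * (π * π)) x (1# - f * b) →
      Near total π ((π * π * π) * x * (1# * 1# * 1#)) 1#
    entry₂₂ (k , p) = π * π * k - f * (c * π) , trans (*-congʳ (*-congˡ p))
      (solve 5 (λ s π c f k → (π :* π :* π) :* (s :* ((:1 :+ :- (f :* (c :* (π :* π)))) :+ π :* (π :* π) :* k)) :* (:1 :* :1 :* :1)
        := :total s π :* (:1 :+ π :* (π :* π :* k :+ :- (f :* (c :* π))))) refl s π c f k)

  -- `u′` is an independent word for the inverse E(-f); its error need not be related to that of
  -- `u`.
  squareWord : Carrier → Carrier → Word → Word → Word
  squareWord π c u u′ =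
    diagWord 1# π ++ ((u ++ (lowerWord (c * (π * π)) ++ (u′ ++ lowerWord (- (c * (π * π)))))) ++ diagWord π 1#)

  approx-sandwich : ∀ {π r t D D′ E} d w d′ →
    scale d ≈ r → scale d′ ≈ t → ⟪ d ⟫ ≈ᴹ D → ⟪ d′ ⟫ ≈ᴹ D′ →
    Nearᴹ (r * (scale w * t)) π (D ∙ ⟪ w ⟫ ∙ D′) E → Approximates (d ++ (w ++ d′)) π E
  approx-sandwich d w d′ p q P Q = nearᴹ-resp
    (sym (trans (scale-++ d (w ++ d′)) (*-cong p (trans (scale-++ w d′) (*-congˡ q)))))
    refl
    (sym-M (trans-M (⟪⟫-++ d (w ++ d′)) (∙-cong P (trans-M (⟪⟫-++ w d′) (∙-cong refl-M Q)))))
    refl-M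

  approx-square : ∀ {π} c f u u′ →
    Approximates u (π * (π * π)) (upper f) → Approximates u′ (π * (π * π)) (upper (- f)) →
    Approximates (squareWord π c u u′) π (upper (- (c * (f * f))))
  approx-square {π} c f u u′ p p′ =
    approx-sandwich (diagWord 1# π) (u ++ (lowerWord b ++ (u′ ++ lowerWord (- b)))) (diagWord π 1#)
      (scale-diagWord 1# π) (scale-diagWord π 1#) (⟪diagWord⟫ 1# π) (⟪diagWord⟫ π 1#)
      (conjugated-commutator c f
        (approx-++ u (lowerWord b ++ (u′ ++ lowerWord (- b))) (upper f) (lower b ∙ upper (- f) ∙ lower (- b)) p
          (approx-++ (lowerWord b) (u′ ++ lowerWord (- b)) (lower b) (upper (- f) ∙ lower (- b)) (approx-lower b)
            (approx-++ u′ (lowerWord (- b)) (upper (- f)) (lower (- b)) p′ (approx-lower (- b))))))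
    where b = c * (π * π)

  -- f g = ((f + g)² - (f - g)²) / 4
  productWord : Carrier → Carrier → (u u′ v v′ : Word) → Word
  productWord π q u u′ v v′ = squareWord π (- q) (u ++ v) (u′ ++ v′) ++ squareWord π q (u ++ v′) (u′ ++ v)

  approx-+ : ∀ {π} f g u v → Approximates u π (upper f) → Approximates v π (upper g) →
    Approximates (u ++ v) π (upper (f + g))
  approx-+ f g u v p q = approx-resp (u ++ v) (upper-+ f g) (approx-++ u v (upper f) (upper g) p q)

  -- Keeping `q` free covers both signs: q = 1/4 yields f g and q = -1/4 yields -(f g). The squares
  -- come with coefficient -c, so the word for f + g is built with c = -q and the one for f - g with
  -- c = q.
  approx-product : ∀ {π} q f g u u′ v v′ → let π³ = π * (π * π) in
    Approximates u π³ (upper f) → Approximates u′ π³ (upper (- f)) →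
    Approximates v π³ (upper g) → Approximates v′ π³ (upper (- g)) →
    Approximates (productWord π q u u′ v v′) π (upper (q * ((1# + 1#) * (1# + 1#)) * (f * g)))
  approx-product {π} q f g u u′ v v′ a a′ b b′ =
    approx-resp (productWord π q u u′ v v′)
      (upper-cong (solve 3 (λ q f g → :- ((:- q) :* ((f :+ g) :* (f :+ g))) :+ :- (q :* ((f :+ :- g) :* (f :+ :- g)))
        := q :* ((:1 :+ :1) :* (:1 :+ :1)) :* (f :* g)) refl q f g))
      (approx-+ _ _ (squareWord π (- q) (u ++ v) (u′ ++ v′)) (squareWord π q (u ++ v′) (u′ ++ v))
        (approx-square (- q) (f + g) (u ++ v) (u′ ++ v′) (approx-+ f g u v a b)
          (approx-resp (u′ ++ v′) (upper-cong (solve 2 (λ f g → :- f :+ :- g := :- (f :+ g)) refl f g))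
            (approx-+ (- f) (- g) u′ v′ a′ b′)))
        (approx-square q (f - g) (u ++ v′) (u′ ++ v) (approx-+ f (- g) u v′ a b′)
          (approx-resp (u′ ++ v) (upper-cong (solve 2 (λ f g → :- f :+ g := :- (f :+ :- g)) refl f g))
            (approx-+ (- f) g u′ v a′ b))))

  -- Multiplying by diag(1/d , d) on the left divides the upper row by d. The final letter Q(0)
  -- exchanges the columns, so the entry f of E(f) ends up in the upper left corner, where the
  -- continuant is read off.
  quotientWord : Carrier → Word → Word
  quotientWord d w = diagWord 1# d ++ (w ++ (0# , 1#) ∷ [])

  approx-quotient : ∀ {d ε f g} w → Approximates w (ε * d) (upper f) → f ≈ g * d →
    Near (scale (quotientWord d w)) ε (m₁₁ ⟪ quotientWord d w ⟫) g
  approx-quotient {d} {ε} {f} {g} w (nearᴹ _ (k , p) _ _) q =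
    near-resp scale-eq refl (≈₁₁ word-eq) refl (k , (begin
      1# * 1# * d * m₁₂ ⟪ w ⟫ * 1#                                        ≈⟨ *-congʳ (*-congˡ (trans p (*-congˡ (+-congʳ q)))) ⟩
      1# * 1# * d * (scale w * (g * d + ε * d * k)) * 1#                  ≈⟨ solve 5 (λ d s g ε k →
        :1 :* :1 :* d :* (s :* (g :* d :+ ε :* d :* k)) :* :1 := (:1 :* d :* d) :* (s :* (:1 :* :1)) :* (g :+ ε :* k))
        refl d (scale w) g ε k ⟩
      (1# * d * d) * (scale w * (1# * 1#)) * (g + ε * k)                  ∎))
    where
    end : Word
    end = (0# , 1#) ∷ []
    scale-eq : (1# * d * d) * (scale w * (1# * 1#)) ≈ scale (quotientWord d w)
    scale-eq = sym (trans (scale-++ (diagWord 1# d) (w ++ end)) (*-cong (scale-diagWord 1# d) (scale-++ w end)))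
    word-eq : mat (1# * 1# * d * m₁₂ ⟪ w ⟫ * 1#) (1# * 1# * d * m₁₁ ⟪ w ⟫ * 1#)
                  (d * d * d * m₂₂ ⟪ w ⟫ * 1#) (d * d * d * m₂₁ ⟪ w ⟫ * 1#)
              ≈ᴹ ⟪ quotientWord d w ⟫
    word-eq = sym-M (trans-M (⟪⟫-++ (diagWord 1# d) (w ++ end)) (trans-M (∙-cong (⟪diagWord⟫ 1# d) (⟪⟫-++ w end))
      (swap ⟪ w ⟫)))
      where
      swap : ∀ X → mat (1# * 1# * d) 0# 0# (d * d * d) ∙ X ∙ ⟪ end ⟫ ≈ᴹ
        mat (1# * 1# * d * m₁₂ X * 1#) (1# * 1# * d * m₁₁ X * 1#) (d * d * d * m₂₂ X * 1#) (d * d * d * m₂₁ X * 1#)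
      swap X = eqᴹ
        (solve 5 (λ d x y z w → m₁₁ (product d x y z w) := :1 :* :1 :* d :* y :* :1) refl d (m₁₁ X) (m₁₂ X) (m₂₁ X) (m₂₂ X))
        (solve 5 (λ d x y z w → m₁₂ (product d x y z w) := :1 :* :1 :* d :* x :* :1) refl d (m₁₁ X) (m₁₂ X) (m₂₁ X) (m₂₂ X))
        (solve 5 (λ d x y z w → m₂₁ (product d x y z w) := d :* d :* d :* w :* :1) refl d (m₁₁ X) (m₁₂ X) (m₂₁ X) (m₂₂ X))
        (solve 5 (λ d x y z w → m₂₂ (product d x y z w) := d :* d :* d :* z :* :1) refl d (m₁₁ X) (m₁₂ X) (m₂₁ X) (m₂₂ X))
        where
        product : ∀ {n} → (d x y z w : Polynomial n) → Mat (Polynomial n)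
        product d x y z w = mat (:1 :* :1 :* d) :0 :0 (d :* d :* d)
          Symbolic.∙ mat x y z w Symbolic.∙ Symbolic.⟪ (:0 , :1) ∷ [] ⟫

-- Polynomial rings and evaluation homomorphisms

polyRing : ∀ {c ℓ} → CommutativeRing c ℓ → Set → CommutativeRing c (c Level.⊔ ℓ)
polyRing R V = record
  { Carrier = Poly ; _≈_ = _~_ ; _+_ = _⊕_ ; _*_ = _⊗_ ; -_ = con (- 1#) ⊗_ ; 0# = con 0# ; 1# = con 1#
  ; isCommutativeRing = record
    { isRing = record
      { +-isAbelianGroup = record
        { isGroup = record
          { isMonoid = record
            { isSemigroup = record
              { isMagma = record
                { isEquivalence = record { refl = ~refl ; sym = ~sym ; trans = ~trans }
                ; ∙-cong = ~⊕-cong }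
              ; assoc = ~⊕-assoc }
            ; identity = ~⊕-idˡ , λ p → ~trans (~⊕-comm p _) (~⊕-idˡ p) }
          ; inverse = ~⊕-invˡ , λ p → ~trans (~⊕-comm p _) (~⊕-invˡ p)
          ; ⁻¹-cong = ~⊗-cong ~refl }
        ; comm = ~⊕-comm }
      ; *-cong = ~⊗-cong
      ; *-assoc = ~⊗-assoc
      ; *-identity = ~⊗-idˡ , λ p → ~trans (~⊗-comm p _) (~⊗-idˡ p)
      ; distrib = ~distribˡ , λ p q r → ~trans (~⊗-comm _ p) (~trans (~distribˡ p q r) (~⊕-cong (~⊗-comm p q) (~⊗-comm p r))) }
    ; *-comm = ~⊗-comm } }
  where
  open CommutativeRing R using (-_; 0#; 1#)
  open PolyRing R V

module Evaluation {c ℓ} (R : CommutativeRing c ℓ) {a ℓ′} (S : CommutativeRing a ℓ′) where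
  private
    module R = CommutativeRing R
    module S = CommutativeRing S

  evaluate : ∀ {V} → (V → S.Carrier) → (R.Carrier → S.Carrier) → PolyRing.Poly R V → S.Carrier
  evaluate σ ι (var v) = σ v
  evaluate σ ι (con x) = ι x
  evaluate σ ι (p ⊕ q) = evaluate σ ι p S.+ evaluate σ ι q
  evaluate σ ι (p ⊗ q) = evaluate σ ι p S.* evaluate σ ι q

  record IsRingMap (ι : R.Carrier → S.Carrier) : Set (c Level.⊔ ℓ Level.⊔ ℓ′) where
    field
      cong   : ∀ {x y} → x R.≈ y → ι x S.≈ ι y
      +-homo : ∀ x y → ι x S.+ ι y S.≈ ι (x R.+ y)
      *-homo : ∀ x y → ι x S.* ι y S.≈ ι (x R.* y)
      0-homo : ι R.0# S.≈ S.0#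
      1-homo : ι R.1# S.≈ S.1#

  module _ {V : Set} (σ : V → S.Carrier) {ι : R.Carrier → S.Carrier} (hom : IsRingMap ι) where
    open PolyRing R V
    open IsRingMap hom
    open Relation.Binary.Reasoning.Setoid S.setoid

    evaluate-cong : ∀ {p q} → p ~ q → evaluate σ ι p S.≈ evaluate σ ι q
    evaluate-cong ~refl = S.refl
    evaluate-cong (~sym h) = S.sym (evaluate-cong h)
    evaluate-cong (~trans h h′) = S.trans (evaluate-cong h) (evaluate-cong h′)
    evaluate-cong (~⊕-cong h h′) = S.+-cong (evaluate-cong h) (evaluate-cong h′)
    evaluate-cong (~⊗-cong h h′) = S.*-cong (evaluate-cong h) (evaluate-cong h′)
    evaluate-cong (~⊕-assoc p q r) = S.+-assoc _ _ _
    evaluate-cong (~⊕-comm p q) = S.+-comm _ _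
    evaluate-cong (~⊕-idˡ p) = S.trans (S.+-congʳ 0-homo) (S.+-identityˡ _)
    evaluate-cong (~⊕-invˡ p) = begin
      ι (R.- R.1#) S.* e S.+ e               ≈⟨ S.+-congˡ (S.trans (S.*-congʳ 1-homo) (S.*-identityˡ e)) ⟨
      ι (R.- R.1#) S.* e S.+ ι R.1# S.* e    ≈⟨ S.distribʳ e _ _ ⟨
      (ι (R.- R.1#) S.+ ι R.1#) S.* e        ≈⟨ S.*-congʳ (S.trans (+-homo _ _) (cong (R.-‿inverseˡ R.1#))) ⟩
      ι R.0# S.* e                           ≈⟨ S.trans (S.*-congʳ 0-homo) (S.zeroˡ e) ⟩
      S.0#                                   ≈⟨ 0-homo ⟨
      ι R.0#                                 ∎
      where e = evaluate σ ι p
    evaluate-cong (~⊗-assoc p q r) = S.*-assoc _ _ _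
    evaluate-cong (~⊗-comm p q) = S.*-comm _ _
    evaluate-cong (~⊗-idˡ p) = S.trans (S.*-congʳ 1-homo) (S.*-identityˡ _)
    evaluate-cong (~distribˡ p q r) = S.distribˡ _ _ _
    evaluate-cong (~con-cong h) = cong h
    evaluate-cong (~con-+ x y) = +-homo x y
    evaluate-cong (~con-* x y) = *-homo x y

module _ {c ℓ} (R : CommutativeRing c ℓ) where
  open CommutativeRing R using (refl; _≈_)
  identityMap : Evaluation.IsRingMap R R (λ x → x)
  identityMap = record { cong = λ h → h ; +-homo = λ _ _ → refl ; *-homo = λ _ _ → refl ; 0-homo = refl ; 1-homo = refl }

  conMap : ∀ V → Evaluation.IsRingMap R (polyRing R V) con
  conMap V = record { cong = ~con-cong ; +-homo = ~con-+ ; *-homo = ~con-* ; 0-homo = ~refl ; 1-homo = ~refl }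
    where open PolyRing R V

rename≡evaluate : ∀ {c ℓ} (R : CommutativeRing c ℓ) {V W : Set} (σ : V → W) (p : PolyRing.Poly R V) →
  rename σ p ≡ Evaluation.evaluate R (polyRing R W) (λ v → var (σ v)) con p
rename≡evaluate R σ (var v) = ≡.refl
rename≡evaluate R σ (con x) = ≡.refl
rename≡evaluate R σ (p ⊕ q) = ≡.cong₂ _⊕_ (rename≡evaluate R σ p) (rename≡evaluate R σ q)
rename≡evaluate R σ (p ⊗ q) = ≡.cong₂ _⊗_ (rename≡evaluate R σ p) (rename≡evaluate R σ q)

rename-cong : ∀ {c ℓ} (R : CommutativeRing c ℓ) {V W : Set} (σ : V → W) {p q : PolyRing.Poly R V} →
  PolyRing._~_ R V p q → PolyRing._~_ R W (rename σ p) (rename σ q)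
rename-cong R {W = W} σ {p} {q} h = ≡.subst₂ (PolyRing._~_ R W)
  (≡.sym (rename≡evaluate R σ p)) (≡.sym (rename≡evaluate R σ q))
  (Evaluation.evaluate-cong R (polyRing R W) (λ v → var (σ v)) (conMap R W) h)

-- Uncancelled fractions over 𝔽[ε] and realizable letters

module RationalFunctions {c ℓ} (𝔽 : Field c ℓ) where
  module F = Field 𝔽

  εX-ring : CommutativeRing c (c Level.⊔ ℓ)
  εX-ring = polyRing F.commutativeRing (Maybe ℕ)

  open CommutativeRing εX-ring public
  open FibonacciMatrices εX-ring public
  open IntegerCoefficients εX-ring public using (Polynomial; solve; _:=_; _:+_; _:*_; :-_; :0; :1)

  ε : Carrier
  ε = ε-var 𝔽

  numer : Expr ℕ (Fracε 𝔽) → Carrier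
  numer φ = proj₁ (⟦_⟧ 𝔽 φ)

  dens : Expr ℕ (Fracε 𝔽) → List (NonZeroε 𝔽)
  dens φ = proj₂ (⟦_⟧ 𝔽 φ)

  denom-++ : ∀ ds ds′ → denom 𝔽 (ds ++ ds′) ≈ denom 𝔽 ds * denom 𝔽 ds′
  denom-++ [] ds′ = sym (*-identityˡ _)
  denom-++ ((q , _) ∷ ds) ds′ = trans (*-congˡ (denom-++ ds ds′)) (sym (*-assoc _ _ _))

  -- The product is formed inside 𝔽[ε], before embedding, so that it can be the numerator of a
  -- single constant.
  denominator : List (NonZeroε 𝔽) → Polyε 𝔽
  denominator [] = con F.1#
  denominator ((q , _) ∷ ds) = q ⊗ denominator ds

  embed-denominator : ∀ ds → embedε 𝔽 (denominator ds) ≡ denom 𝔽 ds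
  embed-denominator [] = ≡.refl
  embed-denominator ((q , _) ∷ ds) = ≡.cong (embedε 𝔽 q ⊗_) (embed-denominator ds)

  Scalar : Carrier → Set (c Level.⊔ ℓ)
  Scalar x = Σ[ p ∈ Polyε 𝔽 ] (embedε 𝔽 p ≈ x)

  -- A list of nonzero factors is kept instead of a proof that the product is nonzero; products of
  -- invertibles then need only concatenation.
  Invertible : Carrier → Set (c Level.⊔ ℓ)
  Invertible x = Σ[ ds ∈ List (NonZeroε 𝔽) ] (denom 𝔽 ds ≈ x)

  scalar-con : ∀ a → Scalar (con a)
  scalar-con a = con a , refl

  scalar-* : ∀ {x y} → Scalar x → Scalar y → Scalar (x * y)
  scalar-* (p , h) (q , k) = p ⊗ q , *-cong h k

  scalar-neg : ∀ {x} → Scalar x → Scalar (- x)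
  scalar-neg = scalar-* (scalar-con _)

  invertible-1 : Invertible 1#
  invertible-1 = [] , refl

  invertible-* : ∀ {x y} → Invertible x → Invertible y → Invertible (x * y)
  invertible-* (ds , h) (ds′ , h′) = ds ++ ds′ , trans (denom-++ ds ds′) (*-cong h h′)

  invertible⇒scalar : ∀ {x} → Invertible x → Scalar x
  invertible⇒scalar (ds , h) = denominator ds , trans (reflexive (embed-denominator ds)) h

  -- Continuants of fractions

  word : (ℕ → Carrier × Carrier) → ℕ → Word
  word x zero = []
  word x (suc m) = x (suc m) ∷ word x m

  -- Fractions are added over the product of their denominators, so the fraction computed by fib
  -- is the one read off the matrix product, expanded by this factor.
  redundancy : (ℕ → Carrier × Carrier) → ℕ → Carrier
  redundancy x zero = 1#
  redundancy x (suc zero) = 1#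
  redundancy x (suc (suc m)) = redundancy x m * redundancy x (suc m) * scale (word x m)

  scalar-scale : ∀ x → (∀ k → Scalar (proj₂ (x k))) → ∀ m → Scalar (scale (word x m))
  scalar-scale x h zero = scalar-con _
  scalar-scale x h (suc m) = scalar-* (h (suc m)) (scalar-scale x h m)

  scalar-redundancy : ∀ x → (∀ k → Scalar (proj₂ (x k))) → ∀ m → Scalar (redundancy x m)
  scalar-redundancy x h zero = scalar-con _
  scalar-redundancy x h (suc zero) = scalar-con _
  scalar-redundancy x h (suc (suc m)) =
    scalar-* (scalar-* (scalar-redundancy x h m) (scalar-redundancy x h (suc m))) (scalar-scale x h m)

  -- Numerator and denominator are matched separately: transitivity of `_≋_` would require
  -- cancelling a denominator.
  Represents : Expr ℕ (Fracε 𝔽) → Carrier × Carrier → Set (c Level.⊔ ℓ)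
  Represents φ (x , l) = numer φ ≈ x × denom 𝔽 (dens φ) ≈ l

  FibRepresents : (ℕ → Expr ℕ (Fracε 𝔽)) → (ℕ → Carrier × Carrier) → ℕ → Set (c Level.⊔ ℓ)
  FibRepresents ℓs x m = Represents (fib 𝔽 (fracConst 𝔽 F.1#) ℓs m)
    (m₁₁ ⟪ word x m ⟫ * redundancy x m , scale (word x m) * redundancy x m)

  fib-step : ∀ ℓs x → (∀ k → Represents (ℓs k) (x k)) → ∀ m →
    FibRepresents ℓs x m → FibRepresents ℓs x (suc m) → FibRepresents ℓs x (suc (suc m))
  fib-step ℓs x h m ih₀ ih₁ =
    trans (+-cong (*-cong (*-cong (proj₁ (h (suc (suc m)))) (proj₁ ih₁)) (proj₂ ih₀))
                  (*-cong (proj₁ ih₀) dens-eq))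
      -- The factor `l₁ :* a₀ :+ :0 :* y` is the lower left entry of the word of length `suc m`,
      -- unfolded by one letter; it brings in the second term of the recurrence. The denominators
      -- have κ₀ κ₁ s in excess, which is the new redundancy.
      (solve 9 (λ x l l₁ a₁ a₀ y κ₀ κ₁ s →
          (x :* (a₁ :* κ₁)) :* (s :* κ₀) :+ (a₀ :* κ₀) :* (l :* ((l₁ :* s) :* κ₁))
          := (x :* a₁ :+ l :* (l₁ :* a₀ :+ :0 :* y)) :* ((κ₀ :* κ₁) :* s)) refl
        (proj₁ (x (suc (suc m)))) l l₁ (m₁₁ ⟪ word x (suc m) ⟫) (m₁₁ ⟪ word x m ⟫) (m₂₁ ⟪ word x m ⟫)
        (redundancy x m) (redundancy x (suc m)) (scale (word x m))) ,
    trans (denom-++ (dens (ℓs (suc (suc m))) ++ dens (fib 𝔽 one ℓs (suc m))) _)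
      (trans (*-cong dens-eq (proj₂ ih₀))
        (solve 5 (λ l l₁ κ₀ κ₁ s → (l :* ((l₁ :* s) :* κ₁)) :* (s :* κ₀) := (l :* (l₁ :* s)) :* ((κ₀ :* κ₁) :* s)) refl
          l l₁ (redundancy x m) (redundancy x (suc m)) (scale (word x m))))
    where
    one = fracConst 𝔽 F.1#
    l = proj₂ (x (suc (suc m)))
    l₁ = proj₂ (x (suc m))
    dens-eq : denom 𝔽 (dens (ℓs (suc (suc m))) ++ dens (fib 𝔽 one ℓs (suc m))) ≈
      l * (scale (word x (suc m)) * redundancy x (suc m))
    dens-eq = trans (denom-++ (dens (ℓs (suc (suc m)))) _) (*-cong (proj₂ (h (suc (suc m)))) (proj₂ ih₁))

  fib-represents : ∀ ℓs x → (∀ k → Represents (ℓs k) (x k)) → ∀ m → FibRepresents ℓs x m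
  fib-represents ℓs x h zero = sym (*-identityˡ _) , sym (*-identityˡ _)
  fib-represents ℓs x h (suc zero) =
    trans (proj₁ (h 1)) (solve 2 (λ x l → x := (x :* :1 :+ l :* :0) :* :1) refl (proj₁ (x 1)) (proj₂ (x 1))) ,
    trans (proj₂ (h 1)) (solve 1 (λ l → l := (l :* :1) :* :1) refl (proj₂ (x 1)))
  fib-represents ℓs x h (suc (suc m)) =
    fib-step ℓs x h m (fib-represents ℓs x h m) (fib-represents ℓs x h (suc m))

  -- Words whose letters are affine forms

  Realizable : Carrier × Carrier → Set (c Level.⊔ ℓ)
  Realizable x = Σ[ a ∈ Affine 𝔽 ] Represents (affineExpr 𝔽 a) x

  realizable-scalar : ∀ {x l} → Scalar x → Invertible l → Realizable (x , l)
  realizable-scalar (p , h) (ds , k) = affine (p , ds) [] ,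
    trans (solve 2 (λ x l → x :* :1 :+ :0 :* l := x) refl (embedε 𝔽 p) (denom 𝔽 ds)) h ,
    trans (denom-++ ds []) (trans (*-identityʳ _) k)

  -- The coefficient list of the linear form whose only nonzero coefficient, `a`, stands at position
  -- `i`.
  zeros : ℕ → F.Carrier → List (Fracε 𝔽)
  zeros zero a = fracConst 𝔽 a ∷ []
  zeros (suc i) a = fracConst 𝔽 F.0# ∷ zeros i a

  affineFrom-zeros : ∀ j i a → Represents (affineFrom 𝔽 j (zeros i a)) (con a * var (just (i ℕ.+ j)) , 1#)
  affineFrom-zeros j zero a = solve 1 (λ x → x :* :1 :+ :0 :* :1 := x) refl (con a * var (just j)) , refl
  affineFrom-zeros j (suc i) a =
    trans (solve 3 (λ x y z → (:0 :* x) :* y :+ z :* :1 := z) refl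
        (var (just j)) (denom 𝔽 (dens (affineFrom 𝔽 (suc j) (zeros i a)))) (numer (affineFrom 𝔽 (suc j) (zeros i a))))
      (trans (proj₁ ih) (reflexive (≡.cong (λ k → con a ⊗ var (just k)) (ℕₚ.+-suc i j)))) ,
    proj₂ ih
    where ih = affineFrom-zeros (suc j) i a

  realizable-var : ∀ a i → Realizable (con a * var (just i) , 1#)
  realizable-var a i = affine (fracConst 𝔽 F.0#) (zeros i a) ,
    trans (solve 2 (λ y z → :0 :* y :+ z :* :1 := z) refl
        (denom 𝔽 (dens (affineFrom 𝔽 0 (zeros i a)))) (numer (affineFrom 𝔽 0 (zeros i a))))
      (trans (proj₁ ih) (reflexive (≡.cong (λ k → con a ⊗ var (just k)) (ℕₚ.+-identityʳ i)))) ,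
    proj₂ ih
    where ih = affineFrom-zeros 0 i a

  realizable-resp : ∀ {x y l} → x ≈ y → Realizable (x , l) → Realizable (y , l)
  realizable-resp h (a , p , q) = a , trans p h , q

  realizable-integral : ∀ {x} → Scalar x → Realizable (x , 1#)
  realizable-integral s = realizable-scalar s invertible-1

  realizable-upperWord : ∀ {f} → Realizable (f , 1#) → All Realizable (upperWord f)
  realizable-upperWord r = r ∷ realizable-integral (scalar-con _) ∷ []

  realizable-lowerWord : ∀ {f} → Realizable (f , 1#) → All Realizable (lowerWord f)
  realizable-lowerWord r = realizable-integral (scalar-con _) ∷ r ∷ []

  realizable-diagWord : ∀ {a b} → Invertible a → Invertible b → All Realizable (diagWord a b)
  realizable-diagWord i j =
    realizable-scalar (invertible⇒scalar i) j ∷ realizable-scalar (scalar-neg (invertible⇒scalar j)) i ∷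
    realizable-scalar (invertible⇒scalar i) j ∷ 0′ ∷ -1′ ∷ realizable-integral (scalar-con _) ∷ -1′ ∷ 0′ ∷ []
    where
    0′ = realizable-integral (scalar-con F.0#)
    -1′ = realizable-integral (scalar-neg (scalar-con F.1#))

  realizable-squareWord : ∀ {π c u u′} → Invertible π → Scalar c → All Realizable u → All Realizable u′ →
    All Realizable (squareWord π c u u′)
  realizable-squareWord i s r r′ = Allₚ.++⁺ (realizable-diagWord invertible-1 i)
    (Allₚ.++⁺ (Allₚ.++⁺ r (Allₚ.++⁺ (realizable-lowerWord (realizable-integral cπ²))
        (Allₚ.++⁺ r′ (realizable-lowerWord (realizable-integral (scalar-neg cπ²))))))
      (realizable-diagWord i invertible-1))
    where cπ² = scalar-* s (scalar-* (invertible⇒scalar i) (invertible⇒scalar i))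

  realizable-productWord : ∀ {π q u u′ v v′} → Invertible π → Scalar q →
    All Realizable u → All Realizable u′ → All Realizable v → All Realizable v′ →
    All Realizable (productWord π q u u′ v v′)
  realizable-productWord i s u u′ v v′ = Allₚ.++⁺
    (realizable-squareWord i (scalar-neg s) (Allₚ.++⁺ u v) (Allₚ.++⁺ u′ v′))
    (realizable-squareWord i s (Allₚ.++⁺ u v′) (Allₚ.++⁺ u′ v))

  -- The overhead is 8 + 8 for the two diagonal words and 2 + 2 for the two lower triangular ones.
  length-squareWord : ∀ π c u u′ → length (squareWord π c u u′) ≡ 20 ℕ.+ (length u ℕ.+ length u′)
  length-squareWord π c u u′
    rewrite Listₚ.length-++ (u ++ (lowerWord (c * (π * π)) ++ (u′ ++ lowerWord (- (c * (π * π)))))) {diagWord π 1#}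
          | Listₚ.length-++ u {lowerWord (c * (π * π)) ++ (u′ ++ lowerWord (- (c * (π * π))))}
          | Listₚ.length-++ u′ {lowerWord (- (c * (π * π)))}
    = ℕsolve 2 (λ a b → kon 8 ⊞ ((a ⊞ (kon 2 ⊞ (b ⊞ kon 2))) ⊞ kon 8) ≔ kon 20 ⊞ (a ⊞ b)) ≡.refl (length u) (length u′)

  -- Each of the two squares contains two concatenated pairs, one word for ±f and one for ±g in
  -- each; this gives the factor 4, and 40 is twice the overhead of a square.
  length-productWord : ∀ π q u u′ v v′ {m n} →
    length u ℕ.≤ m → length u′ ℕ.≤ m → length v ℕ.≤ n → length v′ ℕ.≤ n →
    length (productWord π q u u′ v v′) ℕ.≤ 4 ℕ.* (m ℕ.+ n) ℕ.+ 40
  length-productWord π q u u′ v v′ {m} {n} a a′ b b′ = begin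
    length (productWord π q u u′ v v′)
      ≡⟨ Listₚ.length-++ (squareWord π (- q) (u ++ v) (u′ ++ v′)) ⟩
    length (squareWord π (- q) (u ++ v) (u′ ++ v′)) ℕ.+ length (squareWord π q (u ++ v′) (u′ ++ v))
      ≡⟨ ≡.cong₂ ℕ._+_ (length-squareWord π (- q) (u ++ v) (u′ ++ v′)) (length-squareWord π q (u ++ v′) (u′ ++ v)) ⟩
    (20 ℕ.+ (length (u ++ v) ℕ.+ length (u′ ++ v′))) ℕ.+ (20 ℕ.+ (length (u ++ v′) ℕ.+ length (u′ ++ v)))
      ≤⟨ ℕₚ.+-mono-≤ (ℕₚ.+-monoʳ-≤ 20 (ℕₚ.+-mono-≤ (++-bound u v a b) (++-bound u′ v′ a′ b′)))
                     (ℕₚ.+-monoʳ-≤ 20 (ℕₚ.+-mono-≤ (++-bound u v′ a b′) (++-bound u′ v a′ b))) ⟩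
    (20 ℕ.+ ((m ℕ.+ n) ℕ.+ (m ℕ.+ n))) ℕ.+ (20 ℕ.+ ((m ℕ.+ n) ℕ.+ (m ℕ.+ n)))
      ≡⟨ ℕsolve 1 (λ a → (kon 20 ⊞ (a ⊞ a)) ⊞ (kon 20 ⊞ (a ⊞ a)) ≔ kon 4 ⊡ a ⊞ kon 40) ≡.refl (m ℕ.+ n) ⟩
    4 ℕ.* (m ℕ.+ n) ℕ.+ 40 ∎
    where
    open ℕₚ.≤-Reasoning
    ++-bound : ∀ u v {m n} → length u ℕ.≤ m → length v ℕ.≤ n → length (u ++ v) ℕ.≤ m ℕ.+ n
    ++-bound u v p q = ℕₚ.≤-trans (ℕₚ.≤-reflexive (Listₚ.length-++ u)) (ℕₚ.+-mono-≤ p q)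

-- Numerical bounds and leaf counts

private
  -- One level of balancing: with pieces of length 2y, the node costs 4(2y + 2y) + 40, its product
  -- with the slope four times the sum of lengths plus 40, and the offset 2y more. The total 74y +
  -- 200 is at most 274y, so 2 · 256 y suffices; 256 is the least power of two that works at y = 1.
  length-step-bound : ∀ y → 1 ℕ.≤ y →
    (4 ℕ.* (2 ℕ.* y ℕ.+ (4 ℕ.* (2 ℕ.* y ℕ.+ 2 ℕ.* y) ℕ.+ 40)) ℕ.+ 40) ℕ.+ 2 ℕ.* y ℕ.≤ 2 ℕ.* (256 ℕ.* y)
  length-step-bound y 1≤y = begin
    (4 ℕ.* (2 ℕ.* y ℕ.+ (4 ℕ.* (2 ℕ.* y ℕ.+ 2 ℕ.* y) ℕ.+ 40)) ℕ.+ 40) ℕ.+ 2 ℕ.* y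
      ≡⟨ ℕsolve 1 (λ y → (kon 4 ⊡ (kon 2 ⊡ y ⊞ (kon 4 ⊡ (kon 2 ⊡ y ⊞ kon 2 ⊡ y) ⊞ kon 40)) ⊞ kon 40) ⊞ kon 2 ⊡ y
           ≔ kon 200 ⊡ kon 1 ⊞ kon 74 ⊡ y) ≡.refl y ⟩
    200 ℕ.* 1 ℕ.+ 74 ℕ.* y
      ≤⟨ ℕₚ.+-monoˡ-≤ (74 ℕ.* y) (ℕₚ.*-monoʳ-≤ 200 1≤y) ⟩
    200 ℕ.* y ℕ.+ 74 ℕ.* y
      ≤⟨ ℕₚ.m≤m+n _ (238 ℕ.* y) ⟩
    (200 ℕ.* y ℕ.+ 74 ℕ.* y) ℕ.+ 238 ℕ.* y
      ≡⟨ ℕsolve 1 (λ y → (kon 200 ⊡ y ⊞ kon 74 ⊡ y) ⊞ kon 238 ⊡ y ≔ kon 2 ⊡ (kon 256 ⊡ y)) ≡.refl y ⟩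
    2 ℕ.* (256 ℕ.* y) ∎
    where open ℕₚ.≤-Reasoning

  widen-leaves : ∀ x y w {z} → x ℕ.+ y ℕ.≤ suc z → (x ℕ.+ w) ℕ.+ y ℕ.≤ suc (z ℕ.+ w)
  widen-leaves x y w p = ℕₚ.≤-trans
    (ℕₚ.≤-reflexive (ℕsolve 3 (λ x y w → (x ⊞ w) ⊞ y ≔ (x ⊞ y) ⊞ w) ≡.refl x y w)) (ℕₚ.+-monoˡ-≤ w p)

-- The summand 1 in the upper bound serves m = 0, where the power is already 1.
binary-ceiling : ∀ m → ∃[ j ] (m ℕ.≤ 2 ℕ.^ j × 2 ℕ.^ j ℕ.≤ 2 ℕ.* m ℕ.+ 1)
binary-ceiling zero = 0 , z≤n , ℕₚ.≤-refl
binary-ceiling (suc m) with binary-ceiling m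
... | j , m≤ , ≤2m with suc m ℕ.≤? 2 ℕ.^ j
...   | yes lt = j , lt , ℕₚ.≤-trans ≤2m (ℕₚ.+-monoˡ-≤ 1 (ℕₚ.*-monoʳ-≤ 2 (ℕₚ.n≤1+n m)))
...   | no ¬lt = suc j ,
        ℕₚ.≤-trans (ℕₚ.+-mono-≤ (ℕₚ.m^n>0 2 j) m≤) (ℕₚ.+-monoʳ-≤ (2 ℕ.^ j) (ℕₚ.m≤m+n _ 0)) ,
        ℕₚ.≤-trans (ℕₚ.*-monoʳ-≤ 2 (ℕₚ.≤-trans (ℕₚ.≤-pred (ℕₚ.≰⇒> ¬lt)) (ℕₚ.n≤1+n m))) (ℕₚ.m≤m+n _ 1)

-- Unlike `size`, this count is additive, so cutting out a subformula changes it by exactly the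
-- leaves removed and inserted.
leaves : ∀ {a} {V : Set} {A : Set a} → Expr V A → ℕ
leaves (var _) = 1
leaves (con _) = 1
leaves (φ ⊕ ψ) = leaves φ ℕ.+ leaves ψ
leaves (φ ⊗ ψ) = leaves φ ℕ.+ leaves ψ

leaves-positive : ∀ {a} {V : Set} {A : Set a} (φ : Expr V A) → 1 ℕ.≤ leaves φ
leaves-positive (var _) = ℕₚ.≤-refl
leaves-positive (con _) = ℕₚ.≤-refl
leaves-positive (φ ⊕ ψ) = ℕₚ.≤-trans (leaves-positive φ) (ℕₚ.m≤m+n _ _)
leaves-positive (φ ⊗ ψ) = ℕₚ.≤-trans (leaves-positive φ) (ℕₚ.m≤m+n _ _)

-- Balancing a formula and simulating it by words

module Simulation {c ℓ} (𝔽 : Field c ℓ) where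
  open RationalFunctions 𝔽

  Formula : Set c
  Formula = Expr ℕ (Polyε 𝔽)

  value : Formula → Carrier
  value (var i) = var (just i)
  value (con p) = embedε 𝔽 p
  value (φ ⊕ ψ) = value φ ⊕ value ψ
  value (φ ⊗ ψ) = value φ ⊗ value ψ

  Computes : Carrier → Carrier → ℕ → Set (c Level.⊔ ℓ)
  Computes π f n = Σ[ w ∈ Word ] (All Realizable w × length w ℕ.≤ n × Approximates w π (upper f))

  -- The length `n` does not depend on `π`. This lets `simulable-*` call its factors at precision
  -- π³; it also calls them with both signs.
  Simulable : Carrier → ℕ → Set (c Level.⊔ ℓ)
  Simulable f n = ∀ {π} → Invertible π → Computes π f n × Computes π (- f) n

  computes-resp : ∀ {π f g n} → f ≈ g → Computes π f n → Computes π g n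
  computes-resp h (w , r , l , p) = w , r , l , approx-resp w (upper-cong h) p

  computes-+ : ∀ {π f g m n} → Computes π f m → Computes π g n → Computes π (f + g) (m ℕ.+ n)
  computes-+ {f = f} {g} (u , r , l , p) (v , r′ , l′ , p′) =
    u ++ v , Allₚ.++⁺ r r′ ,
    ℕₚ.≤-trans (ℕₚ.≤-reflexive (Listₚ.length-++ u)) (ℕₚ.+-mono-≤ l l′) ,
    approx-+ f g u v p p′

  simulable-resp : ∀ {f g n} → f ≈ g → Simulable f n → Simulable g n
  simulable-resp h s i = computes-resp h (proj₁ (s i)) , computes-resp (-‿cong h) (proj₂ (s i))

  simulable-mono : ∀ {f m n} → m ℕ.≤ n → Simulable f m → Simulable f n
  simulable-mono h s i = weaken (proj₁ (s i)) , weaken (proj₂ (s i))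
    where
    weaken : ∀ {π f} → Computes π f _ → Computes π f _
    weaken (w , r , l , p) = w , r , ℕₚ.≤-trans l h , p

  simulable-letter : ∀ {f} → Realizable (f , 1#) → Realizable (- f , 1#) → Simulable f 2
  simulable-letter r r′ i =
    (upperWord _ , realizable-upperWord r , ℕₚ.≤-refl , approx-upper _) ,
    (upperWord _ , realizable-upperWord r′ , ℕₚ.≤-refl , approx-upper _)

  simulable-+ : ∀ {f g m n} → Simulable f m → Simulable g n → Simulable (f + g) (m ℕ.+ n)
  simulable-+ {f} {g} s t i =
    computes-+ (proj₁ (s i)) (proj₁ (t i)) ,
    computes-resp (solve 2 (λ f g → :- f :+ :- g := :- (f :+ g)) refl f g) (computes-+ (proj₂ (s i)) (proj₂ (t i)))

  -- A formula is affine in one occurrence of a subformula: `slope` is the formal derivative at that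
  -- occurrence and `offset` the value with zero put there. Both replace the node by at most one
  -- leaf, hence the `suc`. `node-value` hides whether the node is a sum or a product.
  record Split (t : ℕ) (φ : Formula) : Set (c Level.⊔ ℓ) where
    constructor split-at
    field
      slope offset child₁ child₂ node : Formula
      node-value : ∀ {m} → Simulable (value child₁) m → Simulable (value child₂) m →
                   Simulable (value node) (4 ℕ.* (m ℕ.+ m) ℕ.+ 40)
      child₁-small : leaves child₁ ℕ.≤ t
      child₂-small : leaves child₂ ℕ.≤ t
      node-large   : t ℕ.< leaves node
      slope-leaves  : leaves slope ℕ.+ leaves node ℕ.≤ suc (leaves φ)
      offset-leaves : leaves offset ℕ.+ leaves node ℕ.≤ suc (leaves φ)
      equation : value φ ≈ value slope * value node + value offset

  module _ (quarter : F.Carrier) (quarter-*4 : con quarter * ((1# + 1#) * (1# + 1#)) ≈ 1#) where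

    computes-product : ∀ {π f g m n} q {h} → Scalar q → Invertible π → Simulable f m → Simulable g n →
      q * ((1# + 1#) * (1# + 1#)) * (f * g) ≈ h → Computes π h (4 ℕ.* (m ℕ.+ n) ℕ.+ 40)
    computes-product {π} {f} {g} q s i sf sg e with sf (invertible-* i (invertible-* i i)) | sg (invertible-* i (invertible-* i i))
    ... | (u , r , l , p) , (u′ , r′ , l′ , p′) | (v , t , k , o) , (v′ , t′ , k′ , o′) =
      productWord π q u u′ v v′ , realizable-productWord i s r r′ t t′ ,
      length-productWord π q u u′ v v′ l l′ k k′ ,
      approx-resp (productWord π q u u′ v v′) (upper-cong e) (approx-product q f g u u′ v v′ p p′ o o′)

    simulable-* : ∀ {f g m n} → Simulable f m → Simulable g n → Simulable (f * g) (4 ℕ.* (m ℕ.+ n) ℕ.+ 40)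
    simulable-* {f} {g} s t i =
      computes-product (con quarter) (scalar-con _) i s t (trans (*-congʳ quarter-*4) (*-identityˡ _)) ,
      computes-product (- con quarter) (scalar-neg (scalar-con _)) i s t
        (trans (solve 3 (λ q x y → :- q :* x :* y := :- (q :* x :* y)) refl (con quarter) _ (f * g))
          (-‿cong (trans (*-congʳ quarter-*4) (*-identityˡ _))))

    split-resp : ∀ {t φ ψ} → value φ ≈ value ψ → leaves φ ≡ leaves ψ → Split t φ → Split t ψ
    split-resp h e (split-at a b c₁ c₂ n v s₁ s₂ l la lb eq) = split-at a b c₁ c₂ n v s₁ s₂ l
      (ℕₚ.≤-trans la (ℕₚ.≤-reflexive (≡.cong suc e))) (ℕₚ.≤-trans lb (ℕₚ.≤-reflexive (≡.cong suc e)))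
      (trans (sym h) eq)

    split-⊕ : ∀ {t φ} ψ → Split t φ → Split t (φ ⊕ ψ)
    split-⊕ {t} {φ} ψ (split-at a b c₁ c₂ n v s₁ s₂ l la lb eq) = split-at a (b ⊕ ψ) c₁ c₂ n v s₁ s₂ l
      (ℕₚ.≤-trans la (s≤s (ℕₚ.m≤m+n _ _))) (widen-leaves (leaves b) (leaves n) (leaves ψ) lb)
      (trans (+-congʳ eq) (+-assoc _ _ _))

    -- `ψ` is copied into both slope and offset; this does no harm, because their leaves are bounded
    -- separately.
    split-⊗ : ∀ {t φ} ψ → Split t φ → Split t (φ ⊗ ψ)
    split-⊗ {t} {φ} ψ (split-at a b c₁ c₂ n v s₁ s₂ l la lb eq) = split-at (a ⊗ ψ) (b ⊗ ψ) c₁ c₂ n v s₁ s₂ l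
      (widen-leaves (leaves a) (leaves n) (leaves ψ) la) (widen-leaves (leaves b) (leaves n) (leaves ψ) lb)
      (trans (*-congʳ eq) (solve 4 (λ a n b w → (a :* n :+ b) :* w := (a :* w) :* n :+ b :* w) refl
        (value a) (value n) (value b) (value ψ)))

    split-node : ∀ {t} φ ψ χ → leaves χ ≡ leaves φ ℕ.+ leaves ψ → t ℕ.< leaves χ →
      leaves φ ℕ.≤ t → leaves ψ ℕ.≤ t →
      (∀ {m} → Simulable (value φ) m → Simulable (value ψ) m → Simulable (value χ) (4 ℕ.* (m ℕ.+ m) ℕ.+ 40)) →
      Split t χ
    split-node φ ψ χ e l s₁ s₂ v = split-at (con (con F.1#)) (con (con F.0#)) φ ψ χ v s₁ s₂ l ℕₚ.≤-refl ℕₚ.≤-refl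
      (solve 1 (λ x → x := :1 :* x :+ :0) refl (value χ))

    -- Descend into a child with more than `t` leaves for as long as there is one; where there is
    -- none, the current node has two small children and is cut out. Since `t` is positive, the
    -- descent stops before a leaf.
    split : ∀ {t} φ → 1 ℕ.≤ t → t ℕ.< leaves φ → Split t φ
    split (var i) 1≤t t< = contradiction 1≤t (ℕₚ.<⇒≱ t<)
    split (con p) 1≤t t< = contradiction 1≤t (ℕₚ.<⇒≱ t<)
    split {t} (φ ⊕ ψ) 1≤t t< with leaves φ ℕ.≤? t | leaves ψ ℕ.≤? t
    ... | no φ≰t | _ = split-⊕ ψ (split φ 1≤t (ℕₚ.≰⇒> φ≰t))
    ... | yes _ | no ψ≰t = split-resp (+-comm _ _) (ℕₚ.+-comm (leaves ψ) (leaves φ)) (split-⊕ φ (split ψ 1≤t (ℕₚ.≰⇒> ψ≰t)))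
    ... | yes φ≤t | yes ψ≤t = split-node φ ψ (φ ⊕ ψ) ≡.refl t< φ≤t ψ≤t λ {m} s s′ →
          simulable-mono (ℕₚ.≤-trans (ℕₚ.m≤n*m (m ℕ.+ m) 4) (ℕₚ.m≤m+n _ 40)) (simulable-+ s s′)
    split {t} (φ ⊗ ψ) 1≤t t< with leaves φ ℕ.≤? t | leaves ψ ℕ.≤? t
    ... | no φ≰t | _ = split-⊗ ψ (split φ 1≤t (ℕₚ.≰⇒> φ≰t))
    ... | yes _ | no ψ≰t = split-resp (*-comm _ _) (ℕₚ.+-comm (leaves ψ) (leaves φ)) (split-⊗ φ (split ψ 1≤t (ℕₚ.≰⇒> ψ≰t)))
    ... | yes φ≤t | yes ψ≤t = split-node φ ψ (φ ⊗ ψ) ≡.refl t< φ≤t ψ≤t simulable-*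

    -- The strict inequality `t ℕ.< n` pays for the extra leaf inserted by the cut.
    rest-small : ∀ {t a n l} → l ℕ.≤ 2 ℕ.* t → t ℕ.< n → a ℕ.+ n ℕ.≤ suc l → a ℕ.≤ t
    rest-small {t} {a} {n} {l} l≤ t<n a+n≤ = ℕₚ.+-cancelʳ-≤ (suc t) a t (begin
      a ℕ.+ suc t      ≤⟨ ℕₚ.+-monoʳ-≤ a t<n ⟩
      a ℕ.+ n          ≤⟨ a+n≤ ⟩
      suc l            ≤⟨ s≤s l≤ ⟩
      suc (2 ℕ.* t)    ≡⟨ ℕsolve 1 (λ t → kon 1 ⊞ kon 2 ⊡ t ≔ t ⊞ (kon 1 ⊞ t)) ≡.refl t ⟩
      t ℕ.+ suc t      ∎)
      where open ℕₚ.≤-Reasoning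

    -- Cutting φ = A ν + B at a smallest node ν with more than half of the leaves leaves four formulas
    -- (A, B and the two children of ν) with at most half of the leaves each.
    simulate : ∀ j φ → leaves φ ℕ.≤ 2 ℕ.^ j → Simulable (value φ) (2 ℕ.* 256 ℕ.^ j)
    simulate zero (var i) l = simulable-letter (realizable-resp (*-identityˡ _) (realizable-var F.1# i)) (realizable-var _ i)
    simulate zero (con p) l = simulable-letter (realizable-integral (p , refl)) (realizable-integral (scalar-neg (p , refl)))
    simulate zero (φ ⊕ ψ) l = contradiction l (ℕₚ.<⇒≱ (ℕₚ.+-mono-≤ (leaves-positive φ) (leaves-positive ψ)))
    simulate zero (φ ⊗ ψ) l = contradiction l (ℕₚ.<⇒≱ (ℕₚ.+-mono-≤ (leaves-positive φ) (leaves-positive ψ)))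
    simulate (suc j) φ l with leaves φ ℕ.≤? 2 ℕ.^ j
    ... | yes l′ = simulable-mono (ℕₚ.*-monoʳ-≤ 2 (ℕₚ.m≤n*m (256 ℕ.^ j) 256)) (simulate j φ l′)
    ... | no ¬l′ = simulable-mono (length-step-bound (256 ℕ.^ j) (ℕₚ.m^n>0 256 j))
          (simulable-resp (sym equation)
            (simulable-+ (simulable-* (simulate j slope (rest-small l node-large slope-leaves))
                (node-value (simulate j child₁ child₁-small) (simulate j child₂ child₂-small)))
              (simulate j offset (rest-small l node-large offset-leaves))))
      where open Split (split φ (ℕₚ.m^n>0 2 j) (ℕₚ.≰⇒> ¬l′))

    -- The exponent 8 is the binary logarithm of 256: for 2^j of order s, the length factor 256^j is
    -- the eighth power of 2^j.
    simulate-poly : ∀ φ {s} → leaves φ ℕ.≤ s → Simulable (value φ) (2 ℕ.* (2 ℕ.* s ℕ.+ 1) ℕ.^ 8)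
    simulate-poly φ {s} l with binary-ceiling s
    ... | j , s≤ , ≤2s = simulable-mono (ℕₚ.*-monoʳ-≤ 2 (begin
            256 ℕ.^ j                ≡⟨ ℕₚ.^-*-assoc 2 8 j ⟩
            2 ℕ.^ (8 ℕ.* j)          ≡⟨ ≡.cong (2 ℕ.^_) (ℕₚ.*-comm 8 j) ⟩
            2 ℕ.^ (j ℕ.* 8)          ≡⟨ ℕₚ.^-*-assoc 2 j 8 ⟨
            (2 ℕ.^ j) ℕ.^ 8          ≤⟨ ℕₚ.^-monoˡ-≤ 8 ≤2s ⟩
            (2 ℕ.* s ℕ.+ 1) ℕ.^ 8    ∎))
          (simulate j φ (ℕₚ.≤-trans l s≤))
      where open ℕₚ.≤-Reasoning

-- Closure properties of polynomially bounded functions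

bounded-≤ : ∀ {s t} → (∀ n → s n ℕ.≤ t n) → PolyBounded t → PolyBounded s
bounded-≤ h (k , b) = k , λ n → ℕₚ.≤-trans (h n) (b n)

bounded-const : ∀ a → PolyBounded (λ _ → a)
bounded-const a = a , λ n → ℕₚ.m≤n+m a _

private
  -- The monomials of the two bounds are compared only for positive n; at n = 0 they vanish.
  combine : ∀ {s : ℕ → ℕ} k → s 0 ℕ.≤ k → (∀ n → s (suc n) ℕ.≤ k ℕ.* suc n ℕ.^ k) → PolyBounded s
  combine k h₀ h = k , λ { zero → ℕₚ.≤-trans h₀ (ℕₚ.m≤n+m k _) ; (suc n) → ℕₚ.≤-trans (h n) (ℕₚ.m≤m+n _ k) }

  at-zero : ∀ k → k ℕ.* 0 ℕ.^ k ℕ.+ k ≡ k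
  at-zero zero = ≡.refl
  at-zero (suc k) = ≡.cong (ℕ._+ suc k) (ℕₚ.*-zeroʳ (suc k))

  at-suc : ∀ k n → k ℕ.* suc n ℕ.^ k ℕ.+ k ℕ.≤ 2 ℕ.* k ℕ.* suc n ℕ.^ k
  at-suc k n = begin
    k ℕ.* y ℕ.+ k        ≡⟨ ≡.cong (k ℕ.* y ℕ.+_) (ℕₚ.*-identityʳ k) ⟨
    k ℕ.* y ℕ.+ k ℕ.* 1  ≤⟨ ℕₚ.+-monoʳ-≤ (k ℕ.* y) (ℕₚ.*-monoʳ-≤ k (ℕₚ.m^n>0 (suc n) k)) ⟩
    k ℕ.* y ℕ.+ k ℕ.* y  ≡⟨ ℕsolve 2 (λ k y → k ⊡ y ⊞ k ⊡ y ≔ (kon 2 ⊡ k) ⊡ y) ≡.refl k y ⟩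
    2 ℕ.* k ℕ.* y        ∎
    where
    open ℕₚ.≤-Reasoning
    y = suc n ℕ.^ k

  monomial-mono : ∀ {a b k l} n → a ℕ.≤ b → k ℕ.≤ l → a ℕ.* suc n ℕ.^ k ℕ.≤ b ℕ.* suc n ℕ.^ l
  monomial-mono n p q = ℕₚ.*-mono-≤ p (ℕₚ.^-monoʳ-≤ (suc n) q)

bounded-+ : ∀ {s t} → PolyBounded s → PolyBounded t → PolyBounded (λ n → s n ℕ.+ t n)
bounded-+ {s} {t} (k , p) (l , q) = combine (2 ℕ.* k ℕ.+ 2 ℕ.* l)
  (begin
    s 0 ℕ.+ t 0               ≤⟨ ℕₚ.+-mono-≤ (p 0) (q 0) ⟩
    _                         ≡⟨ ≡.cong₂ ℕ._+_ (at-zero k) (at-zero l) ⟩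
    k ℕ.+ l                   ≤⟨ ℕₚ.+-mono-≤ (ℕₚ.m≤n*m k 2) (ℕₚ.m≤n*m l 2) ⟩
    2 ℕ.* k ℕ.+ 2 ℕ.* l       ∎)
  λ n → begin
    s (suc n) ℕ.+ t (suc n)   ≤⟨ ℕₚ.+-mono-≤ (ℕₚ.≤-trans (p (suc n)) (at-suc k n)) (ℕₚ.≤-trans (q (suc n)) (at-suc l n)) ⟩
    2 ℕ.* k ℕ.* suc n ℕ.^ k ℕ.+ 2 ℕ.* l ℕ.* suc n ℕ.^ l
      ≤⟨ ℕₚ.+-mono-≤ (monomial-mono {2 ℕ.* k} n ℕₚ.≤-refl (ℕₚ.≤-trans (ℕₚ.m≤n*m k 2) (ℕₚ.m≤m+n _ _)))
                     (monomial-mono {2 ℕ.* l} n ℕₚ.≤-refl (ℕₚ.≤-trans (ℕₚ.m≤n*m l 2) (ℕₚ.m≤n+m _ (2 ℕ.* k)))) ⟩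
    2 ℕ.* k ℕ.* suc n ℕ.^ (2 ℕ.* k ℕ.+ 2 ℕ.* l) ℕ.+ 2 ℕ.* l ℕ.* suc n ℕ.^ (2 ℕ.* k ℕ.+ 2 ℕ.* l)
      ≡⟨ ℕₚ.*-distribʳ-+ (suc n ℕ.^ (2 ℕ.* k ℕ.+ 2 ℕ.* l)) (2 ℕ.* k) (2 ℕ.* l) ⟨
    (2 ℕ.* k ℕ.+ 2 ℕ.* l) ℕ.* suc n ℕ.^ (2 ℕ.* k ℕ.+ 2 ℕ.* l) ∎
  where open ℕₚ.≤-Reasoning

bounded-* : ∀ {s t} → PolyBounded s → PolyBounded t → PolyBounded (λ n → s n ℕ.* t n)
bounded-* {s} {t} (k , p) (l , q) = combine K
  (begin
    s 0 ℕ.* t 0               ≤⟨ ℕₚ.*-mono-≤ (p 0) (q 0) ⟩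
    _                         ≡⟨ ≡.cong₂ ℕ._*_ (at-zero k) (at-zero l) ⟩
    k ℕ.* l                   ≤⟨ ℕₚ.*-mono-≤ (ℕₚ.m≤n*m k 2) (ℕₚ.m≤n*m l 2) ⟩
    2 ℕ.* k ℕ.* (2 ℕ.* l)     ≤⟨ ℕₚ.m≤m+n _ _ ⟩
    K                         ∎)
  λ n → begin
    s (suc n) ℕ.* t (suc n)   ≤⟨ ℕₚ.*-mono-≤ (ℕₚ.≤-trans (p (suc n)) (at-suc k n)) (ℕₚ.≤-trans (q (suc n)) (at-suc l n)) ⟩
    (2 ℕ.* k ℕ.* suc n ℕ.^ k) ℕ.* (2 ℕ.* l ℕ.* suc n ℕ.^ l)
      ≡⟨ ℕsolve 4 (λ a x b y → (a ⊡ x) ⊡ (b ⊡ y) ≔ (a ⊡ b) ⊡ (x ⊡ y)) ≡.refl (2 ℕ.* k) (suc n ℕ.^ k) (2 ℕ.* l) (suc n ℕ.^ l) ⟩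
    (2 ℕ.* k ℕ.* (2 ℕ.* l)) ℕ.* (suc n ℕ.^ k ℕ.* suc n ℕ.^ l)
      ≡⟨ ≡.cong ((2 ℕ.* k ℕ.* (2 ℕ.* l)) ℕ.*_) (ℕₚ.^-distribˡ-+-* (suc n) k l) ⟨
    (2 ℕ.* k ℕ.* (2 ℕ.* l)) ℕ.* suc n ℕ.^ (k ℕ.+ l)
      ≤⟨ monomial-mono {2 ℕ.* k ℕ.* (2 ℕ.* l)} {K} {k ℕ.+ l} {K} n (ℕₚ.m≤m+n _ _) (ℕₚ.m≤n+m (k ℕ.+ l) (2 ℕ.* k ℕ.* (2 ℕ.* l))) ⟩
    K ℕ.* suc n ℕ.^ K ∎
  where
  open ℕₚ.≤-Reasoning
  -- A single number has to serve as coefficient, exponent and additive constant, so it must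
  -- dominate both 4kl and k + l.
  K = 2 ℕ.* k ℕ.* (2 ℕ.* l) ℕ.+ (k ℕ.+ l)

bounded-^ : ∀ {s} → PolyBounded s → ∀ e → PolyBounded (λ n → s n ℕ.^ e)
bounded-^ h zero = bounded-const 1
bounded-^ h (suc e) = bounded-* h (bounded-^ h e)

-- From approximating formulas to continuants

module ClosureToFibonacci {c ℓ} (𝔽 : Field c ℓ) (2≉0 : ¬ (Field._≈_ 𝔽 (Field._+_ 𝔽 (Field.1# 𝔽) (Field.1# 𝔽)) (Field.0# 𝔽))) where
  open RationalFunctions 𝔽
  open Simulation 𝔽
  open PolyRing F.commutativeRing (Maybe ℕ) using (~con-cong; ~con-+; ~con-*)
  open Relation.Binary.Reasoning.Setoid setoid

  -- Here char ≠ 2 enters; the square of this element is the 1/4 of the product formula.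
  half : F.Carrier
  half = proj₁ (F.inverse _ 2≉0)

  2*half : (1# + 1#) * con half ≈ 1#
  2*half = trans (*-congʳ (~con-+ F.1# F.1#)) (trans (~con-* _ half) (~con-cong (proj₂ (F.inverse _ 2≉0))))

  quarter-*4 : con (half F.* half) * ((1# + 1#) * (1# + 1#)) ≈ 1#
  quarter-*4 = begin
    con (half F.* half) * ((1# + 1#) * (1# + 1#))           ≈⟨ *-congʳ (~con-* half half) ⟨
    (con half * con half) * ((1# + 1#) * (1# + 1#))         ≈⟨ solve 2 (λ h t → (h :* h) :* (t :* t) := (t :* h) :* (t :* h)) refl (con half) (1# + 1#) ⟩
    ((1# + 1#) * con half) * ((1# + 1#) * con half)         ≈⟨ *-cong 2*half 2*half ⟩
    1# * 1#                                                 ≈⟨ *-identityˡ 1# ⟩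
    1#                                                      ∎

  -- This follows `⟦_⟧` clause by clause, so its value is the numerator by plain equality. A whole
  -- denominator is one constant of 𝔽[ε], and each sum gains just two leaves.
  clear : Expr ℕ (Fracε 𝔽) → Formula
  clear (var i) = var i
  clear (con (p , ds)) = con p
  clear (φ ⊕ ψ) = clear φ ⊗ con (denominator (dens ψ)) ⊕ clear ψ ⊗ con (denominator (dens φ))
  clear (φ ⊗ ψ) = clear φ ⊗ clear ψ

  value-clear : ∀ φ → value (clear φ) ≡ numer φ
  value-clear (var i) = ≡.refl
  value-clear (con (p , ds)) = ≡.refl
  value-clear (φ ⊕ ψ) = ≡.cong₂ _⊕_ (≡.cong₂ _⊗_ (value-clear φ) (embed-denominator (dens ψ)))
                                    (≡.cong₂ _⊗_ (value-clear ψ) (embed-denominator (dens φ)))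
  value-clear (φ ⊗ ψ) = ≡.cong₂ _⊗_ (value-clear φ) (value-clear ψ)

  triple-sum : ∀ {a b} s t → a ℕ.≤ 3 ℕ.* s → b ℕ.≤ 3 ℕ.* t → a ℕ.+ b ℕ.≤ 3 ℕ.* suc (s ℕ.+ t)
  triple-sum s t p q = ℕₚ.≤-trans (ℕₚ.+-mono-≤ p q)
    (ℕₚ.≤-trans (ℕₚ.≤-reflexive (≡.sym (ℕₚ.*-distribˡ-+ 3 s t))) (ℕₚ.*-monoʳ-≤ 3 (ℕₚ.n≤1+n _)))

  -- The added 2 pays in the induction for the two constants inserted at a sum.
  leaves-clear : ∀ φ → leaves (clear φ) ℕ.+ 2 ℕ.≤ 3 ℕ.* size φ
  leaves-clear (var i) = ℕₚ.≤-refl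
  leaves-clear (con _) = ℕₚ.≤-refl
  leaves-clear (φ ⊕ ψ) = ℕₚ.≤-trans
    (ℕₚ.≤-reflexive (ℕsolve 2 (λ a b → ((a ⊞ kon 1) ⊞ (b ⊞ kon 1)) ⊞ kon 2 ≔ (a ⊞ kon 2) ⊞ (b ⊞ kon 2)) ≡.refl
      (leaves (clear φ)) (leaves (clear ψ))))
    (triple-sum (size φ) (size ψ) (leaves-clear φ) (leaves-clear ψ))
  leaves-clear (φ ⊗ ψ) = ℕₚ.≤-trans
    (ℕₚ.≤-trans (ℕₚ.m≤m+n _ 2)
      (ℕₚ.≤-reflexive (ℕsolve 2 (λ a b → ((a ⊞ b) ⊞ kon 2) ⊞ kon 2 ≔ (a ⊞ kon 2) ⊞ (b ⊞ kon 2)) ≡.refl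
        (leaves (clear φ)) (leaves (clear ψ)))))
    (triple-sum (size φ) (size ψ) (leaves-clear φ) (leaves-clear ψ))

  -- Evaluation at ε = 1 would turn such an equation into 1 ≈ 0 in 𝔽.
  ε≁0 : ¬ (_~ε_ 𝔽 (var tt) (con F.0#))
  ε≁0 h = F.1≉0 (Evaluation.evaluate-cong F.commutativeRing F.commutativeRing (λ _ → F.1#) (identityMap F.commutativeRing) h)

  invertible-ε : Invertible ε
  invertible-ε = (var tt , ε≁0) ∷ [] , *-identityʳ ε

  RealizedLetter : Set (c Level.⊔ ℓ)
  RealizedLetter = Σ[ x ∈ Carrier × Carrier ] Realizable x

  -- Positions count from the right end, starting at 1, because `word` puts the argument of highest
  -- index first. Index 0 and indices beyond the length get the dummy letter 1/1, since `fib`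
  -- expects arguments for all indices.
  letterAt : ∀ {w} → All Realizable w → ℕ → RealizedLetter
  letterAt [] k = (1# , 1#) , realizable-integral (scalar-con F.1#)
  letterAt {y ∷ w} (r ∷ rs) k with k ℕ.≟ suc (length w)
  ... | yes _ = y , r
  ... | no _ = letterAt rs k

  word-cong : ∀ {x y} m → (∀ k → k ℕ.≤ m → x k ≡ y k) → word x m ≡ word y m
  word-cong zero h = ≡.refl
  word-cong (suc m) h = ≡.cong₂ _∷_ (h (suc m) ℕₚ.≤-refl) (word-cong m λ k k≤m → h k (ℕₚ.m≤n⇒m≤1+n k≤m))

  word-letterAt : ∀ {w} (rs : All Realizable w) → word (λ k → proj₁ (letterAt rs k)) (length w) ≡ w
  word-letterAt [] = ≡.refl
  word-letterAt {y ∷ w} (r ∷ rs) = ≡.cong₂ _∷_ head (≡.trans (word-cong (length w) tail) (word-letterAt rs))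
    where
    head : proj₁ (letterAt (r ∷ rs) (suc (length w))) ≡ y
    head with suc (length w) ℕ.≟ suc (length w)
    ... | yes _ = ≡.refl
    ... | no ≢ = contradiction ≡.refl ≢
    tail : ∀ k → k ℕ.≤ length w → proj₁ (letterAt (r ∷ rs) k) ≡ proj₁ (letterAt rs k)
    tail k k≤ with k ℕ.≟ suc (length w)
    ... | yes ≡.refl = contradiction k≤ ℕₚ.1+n≰n
    ... | no _ = ≡.refl

  realizable-quotientWord : ∀ {d w} → Invertible d → All Realizable w → All Realizable (quotientWord d w)
  realizable-quotientWord i r = Allₚ.++⁺ (realizable-diagWord invertible-1 i)
    (Allₚ.++⁺ r (realizable-integral (scalar-con F.0#) ∷ []))

  εsum-divisible : ∀ fs e → Σ[ g ∈ Carrier ] (εsum 𝔽 fs e ≈ ε * g)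
  εsum-divisible fs zero = 0# , solve 1 (λ e → :0 := e :* :0) refl ε
  εsum-divisible fs (suc e) with εsum-divisible fs e
  ... | g , h = g + εpow 𝔽 e * embedX 𝔽 (fs (suc e)) ,
    trans (+-congʳ h) (solve 4 (λ e g p f → e :* g :+ (e :* p) :* f := e :* (g :+ p :* f)) refl ε g (εpow 𝔽 e) _)

  -- The numerator and the denominator of the continuant carry the same redundancy κ, so the
  -- cross-multiplied equation is the one from `Near` multiplied by κ, and nothing is cancelled.
  fib-approximation : ∀ {f g x} w → All Realizable w → x ≈ embedX 𝔽 f + ε * g →
    Near (scale w) ε (m₁₁ ⟪ w ⟫) x → FibApprox 𝔽 f (length w)
  fib-approximation {f} {g} {x} w rs x≈ (k , near) =
    (λ i → proj₁ (proj₂ (letterAt rs i))) , g + k , (begin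
      numer φ * 1#                                            ≈⟨ *-identityʳ _ ⟩
      numer φ                                                 ≈⟨ proj₁ represents ⟩
      m₁₁ ⟪ word y (length w) ⟫ * κ                           ≡⟨ ≡.cong (λ v → m₁₁ ⟪ v ⟫ * κ) (word-letterAt rs) ⟩
      m₁₁ ⟪ w ⟫ * κ                                           ≈⟨ *-congʳ (trans near (*-congˡ (+-congʳ x≈))) ⟩
      (scale w * ((embedX 𝔽 f + ε * g) + ε * k)) * κ          ≈⟨ solve 6 (λ s f e g k κ →
        (s :* ((f :+ e :* g) :+ e :* k)) :* κ := (f :+ e :* (g :+ k)) :* (s :* κ)) refl (scale w) (embedX 𝔽 f) ε g k κ ⟩
      (embedX 𝔽 f + ε * (g + k)) * (scale w * κ)              ≡⟨ ≡.cong (λ v → (embedX 𝔽 f + ε * (g + k)) * (scale v * κ)) (word-letterAt rs) ⟨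
      (embedX 𝔽 f + ε * (g + k)) * (scale (word y (length w)) * κ) ≈⟨ *-congˡ (proj₂ represents) ⟨
      (embedX 𝔽 f + ε * (g + k)) * denom 𝔽 (dens φ)           ∎)
    where
    y = λ i → proj₁ (letterAt rs i)
    κ = redundancy y (length w)
    ℓs = λ i → affineExpr 𝔽 (proj₁ (proj₂ (letterAt rs i)))
    φ = fib 𝔽 (fracConst 𝔽 F.1#) ℓs (length w)
    represents = fib-represents ℓs y (λ i → proj₂ (proj₂ (letterAt rs i))) (length w)

  -- The 8 letters of diag(1/d , d), the simulation of a cleared formula with at most 3s leaves, and
  -- the final letter Q(0).
  fibonacci-length : ℕ → ℕ
  fibonacci-length s = 8 ℕ.+ (2 ℕ.* (2 ℕ.* (3 ℕ.* s) ℕ.+ 1) ℕ.^ 8 ℕ.+ 1)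

  formula⇒fibonacci : ∀ f g φ → _≋_ 𝔽 (⟦_⟧ 𝔽 φ) (embedX 𝔽 f + ε * g , []) →
    BorderFibAtMost 𝔽 f (fibonacci-length (size φ))
  formula⇒fibonacci f g φ h = length (quotientWord d w) , length-bound ,
    fib-approximation {f} {g} (quotientWord d w) (realizable-quotientWord (dens φ , refl) (proj₁ (proj₂ simulation))) refl
      (approx-quotient w (proj₂ (proj₂ (proj₂ simulation)))
        (trans (reflexive (value-clear φ)) (trans (sym (*-identityʳ _)) h)))
    where
    d = denom 𝔽 (dens φ)
    simulation : Computes (ε * d) (value (clear φ)) (2 ℕ.* (2 ℕ.* (3 ℕ.* size φ) ℕ.+ 1) ℕ.^ 8)
    simulation = proj₁ (simulate-poly (half F.* half) quarter-*4 (clear φ)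
      (ℕₚ.≤-trans (ℕₚ.m≤m+n _ 2) (leaves-clear φ)) (invertible-* invertible-ε (dens φ , refl)))
    w = proj₁ simulation
    length-bound : length (quotientWord d w) ℕ.≤ fibonacci-length (size φ)
    length-bound = ℕₚ.+-monoʳ-≤ 8 (ℕₚ.≤-trans (ℕₚ.≤-reflexive (Listₚ.length-++ w))
      (ℕₚ.+-monoˡ-≤ 1 (proj₁ (proj₂ (proj₂ simulation)))))

  bounded-fibonacci-length : ∀ {s} → PolyBounded s → PolyBounded (λ n → fibonacci-length (s n))
  bounded-fibonacci-length {s} h =
    bounded-+ {λ _ → 8} {λ n → 2 ℕ.* (2 ℕ.* (3 ℕ.* s n) ℕ.+ 1) ℕ.^ 8 ℕ.+ 1} (bounded-const 8)
      (bounded-+ {λ n → 2 ℕ.* (2 ℕ.* (3 ℕ.* s n) ℕ.+ 1) ℕ.^ 8} {λ _ → 1}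
        (bounded-* {λ _ → 2} {λ n → (2 ℕ.* (3 ℕ.* s n) ℕ.+ 1) ℕ.^ 8} (bounded-const 2)
          (bounded-^ {λ n → 2 ℕ.* (3 ℕ.* s n) ℕ.+ 1}
            (bounded-+ {λ n → 2 ℕ.* (3 ℕ.* s n)} {λ _ → 1}
              (bounded-* {λ _ → 2} {λ n → 3 ℕ.* s n} (bounded-const 2) (bounded-* {λ _ → 3} {s} (bounded-const 3) h))
              (bounded-const 1)) 8))
        (bounded-const 1))

  closure⇒fibonacci : ∀ f → InVPeClosure 𝔽 f → PolyBorderFib 𝔽 f
  closure⇒fibonacci f (e , fs , _ , φ , bounded , computes) =
    (λ n → fibonacci-length (size (φ n))) , bounded-fibonacci-length bounded ,
    λ n → formula⇒fibonacci (f n) (proj₁ (εsum-divisible (fs n) (e n))) (φ n)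
      (trans (computes n) (*-congʳ (+-congˡ (proj₂ (εsum-divisible (fs n) (e n))))))

-- From continuants to approximating formulas

allVars-rename : ∀ {a} {V W : Set} {A : Set a} {P : V → Set} {Q : W → Set} (σ : V → W) →
  (∀ v → P v → Q (σ v)) → (p : Expr V A) → AllVars P p → AllVars Q (rename σ p)
allVars-rename σ h (var v) a = h v a
allVars-rename σ h (con x) a = tt
allVars-rename σ h (p ⊕ q) (a , b) = allVars-rename σ h p a , allVars-rename σ h q b
allVars-rename σ h (p ⊗ q) (a , b) = allVars-rename σ h p a , allVars-rename σ h q b

module FibonacciToClosure {c ℓ} (𝔽 : Field c ℓ) where
  open RationalFunctions 𝔽
  open Simulation 𝔽
  open PolyRing F.commutativeRing (Maybe ℕ) using (~con-*)
  open Relation.Binary.Reasoning.Setoid setoid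

  -- Numerators of affine forms

  linear : ℕ → List (Polyε 𝔽) → Formula
  linear j [] = con (con F.0#)
  linear j (p ∷ ps) = con p ⊗ var j ⊕ linear (suc j) ps

  linear-scale : ∀ j q ps → value (linear j (map (_⊗ q) ps)) ≈ value (linear j ps) * embedε 𝔽 q
  linear-scale j q [] = sym (zeroˡ _)
  linear-scale j q (p ∷ ps) = trans (+-congˡ (linear-scale (suc j) q ps))
    (solve 4 (λ p q x r → (p :* q) :* x :+ r :* q := (p :* x :+ r) :* q) refl
      (embedε 𝔽 p) (embedε 𝔽 q) (var (just j)) (value (linear (suc j) ps)))

  -- Adding fractions multiplies each coefficient by denominators of others. These lie in 𝔽[ε] and
  -- merge into the coefficient, so the numerator is again a linear form with one constant per
  -- variable.
  affineFrom-linear : ∀ j as → Σ[ ps ∈ List (Polyε 𝔽) ] (numer (affineFrom 𝔽 j as) ≈ value (linear j ps))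
  affineFrom-linear j [] = [] , refl
  affineFrom-linear j ((p , ds) ∷ as) with affineFrom-linear (suc j) as
  ... | ps , h = (p ⊗ denominator ds′) ∷ map (_⊗ denominator (ds ++ [])) ps , (begin
    (embedε 𝔽 p * x) * denom 𝔽 ds′ + numer rest * denom 𝔽 (ds ++ [])
      ≡⟨ ≡.cong₂ (λ d e → (embedε 𝔽 p * x) * d + numer rest * e) (embed-denominator ds′) (embed-denominator (ds ++ [])) ⟨
    (embedε 𝔽 p * x) * embedε 𝔽 (denominator ds′) + numer rest * embedε 𝔽 (denominator (ds ++ []))
      ≈⟨ +-cong (solve 3 (λ p x d → (p :* x) :* d := (p :* d) :* x) refl (embedε 𝔽 p) x (embedε 𝔽 (denominator ds′)))
                (trans (*-congʳ h) (sym (linear-scale (suc j) (denominator (ds ++ [])) ps))) ⟩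
    (embedε 𝔽 p * embedε 𝔽 (denominator ds′)) * x + value (linear (suc j) (map (_⊗ denominator (ds ++ [])) ps)) ∎)
    where
    rest = affineFrom 𝔽 (suc j) as
    ds′ = dens rest
    x = var (just j)

  affine-linear : ∀ a → Σ[ p ∈ Polyε 𝔽 ] Σ[ ps ∈ List (Polyε 𝔽) ]
    (numer (affineExpr 𝔽 a) ≈ embedε 𝔽 p + value (linear 0 ps))
  affine-linear (affine (p , ds) as) with affineFrom-linear 0 as
  ... | ps , h = p ⊗ denominator ds′ , map (_⊗ denominator ds) ps , (begin
    embedε 𝔽 p * denom 𝔽 ds′ + numer rest * denom 𝔽 ds
      ≡⟨ ≡.cong₂ (λ d e → embedε 𝔽 p * d + numer rest * e) (embed-denominator ds′) (embed-denominator ds) ⟨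
    embedε 𝔽 p * embedε 𝔽 (denominator ds′) + numer rest * embedε 𝔽 (denominator ds)
      ≈⟨ +-congˡ (trans (*-congʳ h) (sym (linear-scale 0 (denominator ds) ps))) ⟩
    embedε 𝔽 p * embedε 𝔽 (denominator ds′) + value (linear 0 (map (_⊗ denominator ds) ps)) ∎)
    where
    rest = affineFrom 𝔽 0 as
    ds′ = dens rest

  size-linear : ∀ j n ps → size (linear j (take n ps)) ℕ.≤ 4 ℕ.* n ℕ.+ 1
  size-linear j zero ps = ℕₚ.≤-refl
  size-linear j (suc n) [] = s≤s z≤n
  size-linear j (suc n) (p ∷ ps) = ℕₚ.≤-trans (ℕₚ.+-monoʳ-≤ 4 (size-linear (suc j) n ps))
    (ℕₚ.≤-reflexive (ℕsolve 1 (λ n → kon 4 ⊞ (kon 4 ⊡ n ⊞ kon 1) ≔ kon 4 ⊡ (kon 1 ⊞ n) ⊞ kon 1) ≡.refl n))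

  -- Setting the variables with index at least v to zero

  restrict-var : ℕ → Maybe ℕ → Carrier
  restrict-var v nothing = var nothing
  restrict-var v (just i) with i ℕ.<? v
  ... | yes _ = var (just i)
  ... | no _ = con F.0#

  -- The affine forms may involve arbitrarily many variables, which no bound on m controls. This
  -- homomorphism fixes ε, the scalars and f, and leaves at most v variables in every affine form.
  restrict : ℕ → Carrier → Carrier
  restrict v = Evaluation.evaluate F.commutativeRing εX-ring (restrict-var v) con

  restrict-cong : ∀ v {p q} → p ≈ q → restrict v p ≈ restrict v q
  restrict-cong v = Evaluation.evaluate-cong F.commutativeRing εX-ring (restrict-var v) (conMap F.commutativeRing (Maybe ℕ))

  restrict-< : ∀ {v i} → i ℕ.< v → restrict v (var (just i)) ≡ var (just i)
  restrict-< {v} {i} i<v with i ℕ.<? v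
  ... | yes _ = ≡.refl
  ... | no i≮v = contradiction i<v i≮v

  restrict-≥ : ∀ {v i} → v ℕ.≤ i → restrict v (var (just i)) ≡ 0#
  restrict-≥ {v} {i} v≤i with i ℕ.<? v
  ... | yes i<v = contradiction v≤i (ℕₚ.<⇒≱ i<v)
  ... | no _ = ≡.refl

  restrict-embedε : ∀ v p → restrict v (embedε 𝔽 p) ≡ embedε 𝔽 p
  restrict-embedε v (var _) = ≡.refl
  restrict-embedε v (con _) = ≡.refl
  restrict-embedε v (p ⊕ q) = ≡.cong₂ _⊕_ (restrict-embedε v p) (restrict-embedε v q)
  restrict-embedε v (p ⊗ q) = ≡.cong₂ _⊗_ (restrict-embedε v p) (restrict-embedε v q)

  restrict-scalar : ∀ v {x} → Scalar x → restrict v x ≈ x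
  restrict-scalar v (p , h) = trans (restrict-cong v (sym h)) (trans (reflexive (restrict-embedε v p)) h)

  restrict-embedX : ∀ v h → AllVars (ℕ._< v) h → restrict v (embedX 𝔽 h) ≡ embedX 𝔽 h
  restrict-embedX v (var i) a = restrict-< a
  restrict-embedX v (con _) a = ≡.refl
  restrict-embedX v (p ⊕ q) (a , b) = ≡.cong₂ _⊕_ (restrict-embedX v p a) (restrict-embedX v q b)
  restrict-embedX v (p ⊗ q) (a , b) = ≡.cong₂ _⊗_ (restrict-embedX v p a) (restrict-embedX v q b)

  allVars-restrict : ∀ {Q : Maybe ℕ → Set} v → Q nothing → (∀ i → i ℕ.< v → Q (just i)) → ∀ p → AllVars Q (restrict v p)
  allVars-restrict v q h (var nothing) = q
  allVars-restrict v q h (var (just i)) with i ℕ.<? v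
  ... | yes i<v = h i i<v
  ... | no _ = tt
  allVars-restrict v q h (con _) = tt
  allVars-restrict v q h (p ⊕ p′) = allVars-restrict v q h p , allVars-restrict v q h p′
  allVars-restrict v q h (p ⊗ p′) = allVars-restrict v q h p , allVars-restrict v q h p′

  restrict-linear-≥ : ∀ {v} j ps → v ℕ.≤ j → restrict v (value (linear j ps)) ≈ 0#
  restrict-linear-≥ j [] v≤j = refl
  restrict-linear-≥ {v} j (p ∷ ps) v≤j = trans
    (+-cong (*-congˡ (reflexive (restrict-≥ v≤j))) (restrict-linear-≥ (suc j) ps (ℕₚ.m≤n⇒m≤1+n v≤j)))
    (solve 1 (λ p → p :* :0 :+ :0 := :0) refl (restrict v (embedε 𝔽 p)))

  restrict-linear : ∀ {v} j n ps → j ℕ.+ n ≡ v → restrict v (value (linear j ps)) ≈ value (linear j (take n ps))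
  restrict-linear j zero ps e = restrict-linear-≥ j ps (ℕₚ.≤-reflexive (≡.trans (≡.sym e) (ℕₚ.+-identityʳ j)))
  restrict-linear j (suc n) [] e = refl
  restrict-linear {v} j (suc n) (p ∷ ps) e = +-cong
    (*-cong (reflexive (restrict-embedε v p)) (reflexive (restrict-< (ℕₚ.≤-trans (s≤s (ℕₚ.m≤m+n j n)) (ℕₚ.≤-reflexive e′)))))
    (restrict-linear (suc j) n ps e′)
    where e′ = ≡.trans (≡.sym (ℕₚ.+-suc j n)) e

  restrictᴹ : ℕ → Mat Carrier → Mat Carrier
  restrictᴹ v (mat a b c d) = mat (restrict v a) (restrict v b) (restrict v c) (restrict v d)

  -- A word as a balanced formula

  module Symbols = WordMatrices {A = Formula} _⊕_ _⊗_ (con (con (F.- F.1#)) ⊗_) (con (con F.0#)) (con (con F.1#))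

  valueᴹ : Mat Formula → Mat Carrier
  valueᴹ (mat a b c d) = mat (value a) (value b) (value c) (value d)

  values : Symbols.Word → Word
  values = map λ (x , l) → value x , value l

  -- Words shorter than 2^j are padded with identity matrices. At level zero all but the first
  -- letter are dropped; the length bound in `value-balanced` rules this case out.
  balanced : ℕ → Symbols.Word → Mat Formula
  balanced zero [] = Symbols.𝟙
  balanced zero (x ∷ _) = Symbols.letter x
  balanced (suc j) w = balanced j (take (2 ℕ.^ j) w) Symbols.∙ balanced j (drop (2 ℕ.^ j) w)

  letter-∙-𝟙 : ∀ x → letter x ≈ᴹ letter x ∙ 𝟙
  letter-∙-𝟙 (x , l) = eqᴹ (right x l) (left x l) (right l 0#) (left l 0#)
    where
    right : ∀ x y → x ≈ x * 1# + y * 0#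
    right = solve 2 (λ x y → x := x :* :1 :+ y :* :0) refl
    left : ∀ x y → y ≈ x * 0# + y * 1#
    left = solve 2 (λ x y → y := x :* :0 :+ y :* :1) refl

  value-balanced : ∀ j w → length w ℕ.≤ 2 ℕ.^ j → valueᴹ (balanced j w) ≈ᴹ ⟪ values w ⟫
  value-balanced zero [] l = refl-M
  value-balanced zero (x ∷ []) l = letter-∙-𝟙 _
  value-balanced zero (_ ∷ _ ∷ _) (s≤s ())
  value-balanced (suc j) w l = trans-M
    (∙-cong (value-balanced j (take t w) (ℕₚ.≤-trans (ℕₚ.≤-reflexive (Listₚ.length-take t w)) (ℕₚ.m⊓n≤m t _)))
            (value-balanced j (drop t w) drop-bound))
    (trans-M (sym-M (⟪⟫-++ (values (take t w)) (values (drop t w))))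
      (≡.subst (λ u → ⟪ values (take t w) ++ values (drop t w) ⟫ ≈ᴹ ⟪ u ⟫) rejoin refl-M))
    where
    t = 2 ℕ.^ j
    rejoin : values (take t w) ++ values (drop t w) ≡ values w
    rejoin = ≡.trans (≡.sym (Listₚ.map-++ _ (take t w) (drop t w))) (≡.cong values (Listₚ.take++drop≡id t w))
    drop-bound : length (drop t w) ℕ.≤ t
    drop-bound = ℕₚ.≤-trans (ℕₚ.≤-reflexive (Listₚ.length-drop t w))
      (ℕₚ.m≤n+o⇒m∸n≤o (length w) t (ℕₚ.≤-trans l (ℕₚ.≤-reflexive (≡.cong (t ℕ.+_) (ℕₚ.+-identityʳ t)))))

  record Sizeᴹ≤ (s : ℕ) (X : Mat Formula) : Set where
    constructor sizeᴹ
    field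
      size₁₁ : size (m₁₁ X) ℕ.≤ s
      size₁₂ : size (m₁₂ X) ℕ.≤ s
      size₂₁ : size (m₂₁ X) ℕ.≤ s
      size₂₂ : size (m₂₂ X) ℕ.≤ s

  -- An entry of the product has size at most 4s + 3. This is rounded up to 8s so that j levels cost
  -- 8^j, the cube of 2^j.
  size-∙ : ∀ {s X Y} → 1 ℕ.≤ s → Sizeᴹ≤ s X → Sizeᴹ≤ s Y → Sizeᴹ≤ (8 ℕ.* s) (X Symbols.∙ Y)
  size-∙ {s} 1≤s (sizeᴹ a b c d) (sizeᴹ a′ b′ c′ d′) = sizeᴹ (entry a a′ b c′) (entry a b′ b d′) (entry c a′ d c′) (entry c b′ d d′)
    where
    entry : ∀ {x y z w} → x ℕ.≤ s → y ℕ.≤ s → z ℕ.≤ s → w ℕ.≤ s → suc (suc (x ℕ.+ y) ℕ.+ suc (z ℕ.+ w)) ℕ.≤ 8 ℕ.* s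
    entry p q r t = ℕₚ.≤-trans (s≤s (ℕₚ.+-mono-≤ (s≤s (ℕₚ.+-mono-≤ p q)) (s≤s (ℕₚ.+-mono-≤ r t)))) (ℕₚ.≤-trans
      (ℕₚ.≤-reflexive (ℕsolve 1 (λ s → kon 1 ⊞ ((kon 1 ⊞ (s ⊞ s)) ⊞ (kon 1 ⊞ (s ⊞ s))) ≔ kon 3 ⊡ kon 1 ⊞ kon 4 ⊡ s) ≡.refl s))
      (ℕₚ.≤-trans (ℕₚ.+-monoˡ-≤ (4 ℕ.* s) (ℕₚ.*-monoʳ-≤ 3 1≤s)) (ℕₚ.≤-trans (ℕₚ.m≤m+n _ s)
        (ℕₚ.≤-reflexive (ℕsolve 1 (λ s → (kon 3 ⊡ s ⊞ kon 4 ⊡ s) ⊞ s ≔ kon 8 ⊡ s) ≡.refl s)))))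

  SmallLetter : ℕ → Formula × Formula → Set
  SmallLetter s (x , l) = size x ℕ.≤ s × size l ℕ.≤ s

  size-balanced : ∀ {s} j w → 1 ℕ.≤ s → All (SmallLetter s) w → Sizeᴹ≤ (8 ℕ.^ j ℕ.* s) (balanced j w)
  size-balanced {s} zero [] 1≤s [] = sizeᴹ p p p p
    where p = ℕₚ.≤-trans 1≤s (ℕₚ.m≤m+n s 0)
  size-balanced {s} zero (x ∷ _) 1≤s ((p , q) ∷ _) = sizeᴹ (up p) (up q) (up q) (up 1≤s)
    where
    up : ∀ {k} → k ℕ.≤ s → k ℕ.≤ s ℕ.+ 0
    up h = ℕₚ.≤-trans h (ℕₚ.m≤m+n s 0)
  size-balanced {s} (suc j) w 1≤s a = ≡.subst (λ k → Sizeᴹ≤ k (balanced (suc j) w)) (≡.sym (ℕₚ.*-assoc 8 (8 ℕ.^ j) s))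
    (size-∙ (ℕₚ.*-mono-≤ (ℕₚ.m^n>0 8 j) 1≤s)
      (size-balanced j (take (2 ℕ.^ j) w) 1≤s (Allₚ.take⁺ (2 ℕ.^ j) a))
      (size-balanced j (drop (2 ℕ.^ j) w) 1≤s (Allₚ.drop⁺ (2 ℕ.^ j) a)))

  lift : Formula → Expr ℕ (Fracε 𝔽)
  lift (var i) = var i
  lift (con p) = con (p , [])
  lift (φ ⊕ ψ) = lift φ ⊕ lift ψ
  lift (φ ⊗ ψ) = lift φ ⊗ lift ψ

  size-lift : ∀ φ → size (lift φ) ≡ size φ
  size-lift (var i) = ≡.refl
  size-lift (con p) = ≡.refl
  size-lift (φ ⊕ ψ) = ≡.cong suc (≡.cong₂ ℕ._+_ (size-lift φ) (size-lift ψ))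
  size-lift (φ ⊗ ψ) = ≡.cong suc (≡.cong₂ ℕ._+_ (size-lift φ) (size-lift ψ))

  dens-lift : ∀ φ → dens (lift φ) ≡ []
  dens-lift (var i) = ≡.refl
  dens-lift (con p) = ≡.refl
  dens-lift (φ ⊕ ψ) = ≡.cong₂ _++_ (dens-lift φ) (dens-lift ψ)
  dens-lift (φ ⊗ ψ) = ≡.cong₂ _++_ (dens-lift φ) (dens-lift ψ)

  numer-lift : ∀ φ → numer (lift φ) ≈ value φ
  numer-lift (var i) = refl
  numer-lift (con p) = refl
  numer-lift (φ ⊕ ψ) = +-cong
    (trans (*-cong (numer-lift φ) (reflexive (≡.cong (denom 𝔽) (dens-lift ψ)))) (*-identityʳ _))
    (trans (*-cong (numer-lift ψ) (reflexive (≡.cong (denom 𝔽) (dens-lift φ)))) (*-identityʳ _))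
  numer-lift (φ ⊗ ψ) = *-cong (numer-lift φ) (numer-lift ψ)

  -- Expansion in powers of ε

  horner : List (PolyX 𝔽) → Carrier
  horner [] = 0#
  horner (a ∷ as) = embedX 𝔽 a + ε * horner as

  addCoeffs : List (PolyX 𝔽) → List (PolyX 𝔽) → List (PolyX 𝔽)
  addCoeffs [] bs = bs
  addCoeffs (a ∷ as) [] = a ∷ as
  addCoeffs (a ∷ as) (b ∷ bs) = a ⊕ b ∷ addCoeffs as bs

  mulCoeffs : List (PolyX 𝔽) → List (PolyX 𝔽) → List (PolyX 𝔽)
  mulCoeffs [] bs = []
  mulCoeffs (a ∷ as) bs = addCoeffs (map (a ⊗_) bs) (con F.0# ∷ mulCoeffs as bs)

  horner-add : ∀ as bs → horner (addCoeffs as bs) ≈ horner as + horner bs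
  horner-add [] bs = sym (+-identityˡ _)
  horner-add (a ∷ as) [] = sym (+-identityʳ _)
  horner-add (a ∷ as) (b ∷ bs) = trans (+-congˡ (*-congˡ (horner-add as bs)))
    (solve 5 (λ a b e p q → (a :+ b) :+ e :* (p :+ q) := (a :+ e :* p) :+ (b :+ e :* q)) refl
      (embedX 𝔽 a) (embedX 𝔽 b) ε (horner as) (horner bs))

  horner-scale : ∀ a bs → horner (map (a ⊗_) bs) ≈ embedX 𝔽 a * horner bs
  horner-scale a [] = sym (zeroʳ _)
  horner-scale a (b ∷ bs) = trans (+-congˡ (*-congˡ (horner-scale a bs)))
    (solve 4 (λ a b e q → a :* b :+ e :* (a :* q) := a :* (b :+ e :* q)) refl (embedX 𝔽 a) (embedX 𝔽 b) ε (horner bs))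

  horner-mul : ∀ as bs → horner (mulCoeffs as bs) ≈ horner as * horner bs
  horner-mul [] bs = sym (zeroˡ _)
  horner-mul (a ∷ as) bs = trans (horner-add (map (a ⊗_) bs) (con F.0# ∷ mulCoeffs as bs))
    (trans (+-cong (horner-scale a bs) (+-congˡ (*-congˡ (horner-mul as bs))))
      (solve 4 (λ a q e p → a :* q :+ (:0 :+ e :* (p :* q)) := (a :+ e :* p) :* q) refl
        (embedX 𝔽 a) (horner bs) ε (horner as)))

  -- The closure demands the remainder as an explicit polynomial in ε over 𝔽[x]. The expansion is
  -- read off the expression; its length may exceed the degree, since no coefficient is tested for
  -- zero.
  coefficients : Carrier → List (PolyX 𝔽)
  coefficients (var nothing) = con F.0# ∷ con F.1# ∷ []
  coefficients (var (just i)) = var i ∷ []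
  coefficients (con a) = con a ∷ []
  coefficients (p ⊕ q) = addCoeffs (coefficients p) (coefficients q)
  coefficients (p ⊗ q) = mulCoeffs (coefficients p) (coefficients q)

  horner-coefficients : ∀ p → horner (coefficients p) ≈ p
  horner-coefficients (var nothing) = solve 1 (λ e → :0 :+ e :* (:1 :+ e :* :0) := e) refl ε
  horner-coefficients (var (just i)) = solve 2 (λ e x → x :+ e :* :0 := x) refl ε (var (just i))
  horner-coefficients (con a) = solve 2 (λ e x → x :+ e :* :0 := x) refl ε (con a)
  horner-coefficients (p ⊕ q) = trans (horner-add (coefficients p) (coefficients q)) (+-cong (horner-coefficients p) (horner-coefficients q))
  horner-coefficients (p ⊗ q) = trans (horner-mul (coefficients p) (coefficients q)) (*-cong (horner-coefficients p) (horner-coefficients q))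

  nth : List (PolyX 𝔽) → ℕ → PolyX 𝔽
  nth [] k = con F.0#
  nth (a ∷ as) zero = a
  nth (a ∷ as) (suc k) = nth as k

  -- `εsum` grows at the highest power while `horner` unfolds at the lowest; splitting off the
  -- lowest term reconciles the two recursions.
  εsum-shift : ∀ fs e → εsum 𝔽 fs (suc e) ≈ ε * (embedX 𝔽 (fs 1) + εsum 𝔽 (λ k → fs (suc k)) e)
  εsum-shift fs zero = solve 2 (λ e x → :0 :+ (e :* :1) :* x := e :* (x :+ :0)) refl ε (embedX 𝔽 (fs 1))
  εsum-shift fs (suc e) = trans (+-congʳ (εsum-shift fs e))
    (solve 5 (λ e x s p y → e :* (x :+ s) :+ (e :* p) :* y := e :* (x :+ (s :+ p :* y))) refl
      ε (embedX 𝔽 (fs 1)) (εsum 𝔽 (λ k → fs (suc k)) e) (εpow 𝔽 (suc e)) (embedX 𝔽 (fs (suc (suc e)))))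

  -- εsum starts at index 1, so the entry b at index 0 is never read.
  εsum-nth : ∀ b as → εsum 𝔽 (nth (b ∷ as)) (length as) ≈ ε * horner as
  εsum-nth b [] = sym (zeroʳ _)
  εsum-nth b (a ∷ as) = trans (εsum-shift (nth (b ∷ a ∷ as)) (length as)) (*-congˡ (+-congˡ (εsum-nth a as)))

  εcoefficients : Carrier → ℕ → PolyX 𝔽
  εcoefficients g = nth (con F.0# ∷ coefficients g)

  εsum-coefficients : ∀ g → εsum 𝔽 (εcoefficients g) (length (coefficients g)) ≈ ε * g
  εsum-coefficients g = trans (εsum-nth (con F.0#) (coefficients g)) (*-congˡ (horner-coefficients g))

  -- The 2 is for multiplication by one constant; the cube comes from the balanced product of m
  -- matrices; 4v + 3 bounds a letter, with four symbols per variable and three for the constant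
  -- term and the closing zero.
  closure-size : ℕ → ℕ → ℕ
  closure-size m v = 2 ℕ.+ (2 ℕ.* m ℕ.+ 1) ℕ.^ 3 ℕ.* (4 ℕ.* v ℕ.+ 3)

  module _ (ℓs : ℕ → Affine 𝔽) (v : ℕ) where
    fraction : ℕ → Carrier × Carrier
    fraction k = numer (affineExpr 𝔽 (ℓs k)) , denom 𝔽 (dens (affineExpr 𝔽 (ℓs k)))

    constantTerm : ℕ → Polyε 𝔽
    constantTerm k = proj₁ (affine-linear (ℓs k))

    slopes : ℕ → List (Polyε 𝔽)
    slopes k = proj₁ (proj₂ (affine-linear (ℓs k)))

    restrictedLetter : ℕ → Formula × Formula
    restrictedLetter k =
      con (constantTerm k) ⊕ linear 0 (take v (slopes k)) , con (denominator (dens (affineExpr 𝔽 (ℓs k))))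

    restrict-numer : ∀ k → restrict v (proj₁ (fraction k)) ≈ value (proj₁ (restrictedLetter k))
    restrict-numer k = trans (restrict-cong v (proj₂ (proj₂ (affine-linear (ℓs k)))))
      (+-cong (reflexive (restrict-embedε v (constantTerm k))) (restrict-linear 0 v (slopes k) ≡.refl))

    scalar-denom : ∀ k → Scalar (proj₂ (fraction k))
    scalar-denom k = invertible⇒scalar (dens (affineExpr 𝔽 (ℓs k)) , refl)

    restrict-denom : ∀ k → restrict v (proj₂ (fraction k)) ≈ value (proj₂ (restrictedLetter k))
    restrict-denom k = trans (restrict-scalar v (scalar-denom k))
      (sym (reflexive (embed-denominator (dens (affineExpr 𝔽 (ℓs k))))))

    restrictedLetter-small : ∀ k → SmallLetter (4 ℕ.* v ℕ.+ 3) (restrictedLetter k)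
    restrictedLetter-small k =
      ℕₚ.≤-trans (ℕₚ.+-monoʳ-≤ 2 (size-linear 0 v (slopes k)))
        (ℕₚ.≤-reflexive (ℕsolve 1 (λ v → kon 2 ⊞ (v ⊞ kon 1) ≔ v ⊞ kon 3) ≡.refl (4 ℕ.* v))) ,
      ℕₚ.≤-trans (s≤s z≤n) (ℕₚ.m≤n+m 3 (4 ℕ.* v))

    restrictedWord : ℕ → Symbols.Word
    restrictedWord zero = []
    restrictedWord (suc m) = restrictedLetter (suc m) ∷ restrictedWord m

    length-restrictedWord : ∀ m → length (restrictedWord m) ≡ m
    length-restrictedWord zero = ≡.refl
    length-restrictedWord (suc m) = ≡.cong suc (length-restrictedWord m)

    restrictedWord-small : ∀ m → All (SmallLetter (4 ℕ.* v ℕ.+ 3)) (restrictedWord m)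
    restrictedWord-small zero = []
    restrictedWord-small (suc m) = restrictedLetter-small (suc m) ∷ restrictedWord-small m

    restrict-word : ∀ m → restrictᴹ v ⟪ word fraction m ⟫ ≈ᴹ ⟪ values (restrictedWord m) ⟫
    restrict-word zero = refl-M
    restrict-word (suc m) = ∙-cong
      (eqᴹ (restrict-numer (suc m)) (restrict-denom (suc m)) (restrict-denom (suc m)) refl) (restrict-word m)

    -- The balanced product yields the continuant numerator without the redundancy κ, whereas the
    -- list `ds` of denominators includes it. The constant leaf κ/ds restores the fraction that was
    -- given, so κ never has to be cancelled.
    fibonacci⇒formula : ∀ f h g m → _~x_ 𝔽 h f → AllVars (ℕ._< v) h →
      _≋_ 𝔽 (⟦_⟧ 𝔽 (fib 𝔽 (fracConst 𝔽 F.1#) (λ k → affineExpr 𝔽 (ℓs k)) m)) (embedX 𝔽 f + ε * g , []) →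
      Σ[ φ ∈ Expr ℕ (Fracε 𝔽) ] (size φ ℕ.≤ closure-size m v × _≋_ 𝔽 (⟦_⟧ 𝔽 φ) (embedX 𝔽 f + ε * restrict v g , []))
    fibonacci⇒formula f h g m h~f vars eq = con (proj₁ κ , ds) ⊗ lift N , size-bound , (begin
      (embedε 𝔽 (proj₁ κ) * numer (lift N)) * 1#         ≈⟨ *-identityʳ _ ⟩
      embedε 𝔽 (proj₁ κ) * numer (lift N)                ≈⟨ *-cong (sym restrict-κ) (trans (numer-lift N) (sym restrict-N)) ⟩
      restrict v κ′ * restrict v (m₁₁ ⟪ word fraction m ⟫) ≈⟨ *-comm _ _ ⟩
      restrict v (m₁₁ ⟪ word fraction m ⟫ * κ′)          ≈⟨ restrict-cong v (trans (*-identityʳ _) (proj₁ represents)) ⟨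
      restrict v (numer φ * 1#)                          ≈⟨ restrict-cong v eq ⟩
      (restrict v (embedX 𝔽 f) + ε * restrict v g) * restrict v (denom 𝔽 ds)
        ≈⟨ *-cong (+-congʳ restrict-f) (restrict-scalar v (invertible⇒scalar (ds , refl))) ⟩
      (embedX 𝔽 f + ε * restrict v g) * denom 𝔽 ds       ≈⟨ *-congˡ (*-identityʳ _) ⟨
      (embedX 𝔽 f + ε * restrict v g) * (denom 𝔽 ds * denom 𝔽 []) ≡⟨ ≡.cong (λ es → (embedX 𝔽 f + ε * restrict v g) * (denom 𝔽 ds * denom 𝔽 es)) (dens-lift N) ⟨
      (embedX 𝔽 f + ε * restrict v g) * (denom 𝔽 ds * denom 𝔽 (dens (lift N))) ≈⟨ *-congˡ (denom-++ ds (dens (lift N))) ⟨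
      (embedX 𝔽 f + ε * restrict v g) * denom 𝔽 (ds ++ dens (lift N)) ∎)
      where
      φ = fib 𝔽 (fracConst 𝔽 F.1#) (λ k → affineExpr 𝔽 (ℓs k)) m
      ds = dens φ
      represents = fib-represents (λ k → affineExpr 𝔽 (ℓs k)) fraction (λ k → refl , refl) m
      κ′ = redundancy fraction m
      κ = scalar-redundancy fraction scalar-denom m
      j = proj₁ (binary-ceiling m)
      N = m₁₁ (balanced j (restrictedWord m))
      restrict-κ : restrict v κ′ ≈ embedε 𝔽 (proj₁ κ)
      restrict-κ = trans (restrict-scalar v κ) (sym (proj₂ κ))
      restrict-N : restrict v (m₁₁ ⟪ word fraction m ⟫) ≈ value N
      restrict-N = trans (≈₁₁ (restrict-word m)) (sym (≈₁₁ (value-balanced j (restrictedWord m)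
        (ℕₚ.≤-trans (ℕₚ.≤-reflexive (length-restrictedWord m)) (proj₁ (proj₂ (binary-ceiling m)))))))
      restrict-f : restrict v (embedX 𝔽 f) ≈ embedX 𝔽 f
      restrict-f = trans (restrict-cong v (sym embed-h)) (trans (reflexive (restrict-embedX v h vars)) embed-h)
        where
        embed-h : embedX 𝔽 h ≈ embedX 𝔽 f
        embed-h = rename-cong F.commutativeRing just h~f
      size-bound : 2 ℕ.+ size (lift N) ℕ.≤ closure-size m v
      size-bound = ℕₚ.+-monoʳ-≤ 2 (≤R.begin
        size (lift N)                           ≤R.≡⟨ size-lift N ⟩
        size N                                  ≤R.≤⟨ Sizeᴹ≤.size₁₁ (size-balanced j (restrictedWord m) (ℕₚ.≤-trans (s≤s z≤n) (ℕₚ.m≤n+m 3 (4 ℕ.* v))) (restrictedWord-small m)) ⟩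
        8 ℕ.^ j ℕ.* (4 ℕ.* v ℕ.+ 3)             ≤R.≡⟨ ≡.cong (ℕ._* (4 ℕ.* v ℕ.+ 3)) (≡.trans (ℕₚ.^-*-assoc 2 3 j) (≡.trans (≡.cong (2 ℕ.^_) (ℕₚ.*-comm 3 j)) (≡.sym (ℕₚ.^-*-assoc 2 j 3)))) ⟩
        (2 ℕ.^ j) ℕ.^ 3 ℕ.* (4 ℕ.* v ℕ.+ 3)     ≤R.≤⟨ ℕₚ.*-monoˡ-≤ (4 ℕ.* v ℕ.+ 3) (ℕₚ.^-monoˡ-≤ 3 (proj₂ (proj₂ (binary-ceiling m)))) ⟩
        (2 ℕ.* m ℕ.+ 1) ℕ.^ 3 ℕ.* (4 ℕ.* v ℕ.+ 3) ≤R.∎)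
        where module ≤R = ℕₚ.≤-Reasoning

  closure-size-mono : ∀ {m m′} v → m ℕ.≤ m′ → closure-size m v ℕ.≤ closure-size m′ v
  closure-size-mono v h = ℕₚ.+-monoʳ-≤ 2 (ℕₚ.*-monoˡ-≤ (4 ℕ.* v ℕ.+ 3) (ℕₚ.^-monoˡ-≤ 3 (ℕₚ.+-monoˡ-≤ 1 (ℕₚ.*-monoʳ-≤ 2 h))))

  bounded-closure-size : ∀ {p v} → PolyBounded p → PolyBounded v → PolyBounded (λ n → closure-size (p n) (v n))
  bounded-closure-size {p} {v} hp hv =
    bounded-+ {λ _ → 2} {λ n → (2 ℕ.* p n ℕ.+ 1) ℕ.^ 3 ℕ.* (4 ℕ.* v n ℕ.+ 3)} (bounded-const 2)
      (bounded-* {λ n → (2 ℕ.* p n ℕ.+ 1) ℕ.^ 3} {λ n → 4 ℕ.* v n ℕ.+ 3}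
        (bounded-^ {λ n → 2 ℕ.* p n ℕ.+ 1}
          (bounded-+ {λ n → 2 ℕ.* p n} {λ _ → 1} (bounded-* {λ _ → 2} {p} (bounded-const 2) hp) (bounded-const 1)) 3)
        (bounded-+ {λ n → 4 ℕ.* v n} {λ _ → 3} (bounded-* {λ _ → 4} {v} (bounded-const 4) hv) (bounded-const 3)))

  fibonacci⇒closure : ∀ f → PolyManyVars 𝔽 f → PolyBorderFib 𝔽 f → InVPeClosure 𝔽 f
  fibonacci⇒closure f (v , v-bounded , h) (p , p-bounded , approx) =
    (λ n → length (coefficients (g n))) , (λ n → εcoefficients (g n)) ,
    (v , v-bounded , λ n → (embedX 𝔽 (proj₁ (h n)) + ε * g n , []) ,
      *-congʳ (+-cong (rename-cong F.commutativeRing just (proj₁ (proj₂ (h n)))) (sym (εsum-coefficients (g n)))) ,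
      allVars-rename just (λ i i<v → i<v) (proj₁ (h n)) (proj₂ (proj₂ (h n))) ,
      tt , allVars-restrict (v n) tt (λ i i<v → i<v) (remainder n)) ,
    (λ n → proj₁ (formula n)) ,
    bounded-≤ (λ n → ℕₚ.≤-trans (proj₁ (proj₂ (formula n))) (closure-size-mono (v n) (proj₁ (proj₂ (approx n)))))
      (bounded-closure-size p-bounded v-bounded) ,
    λ n → trans (proj₂ (proj₂ (formula n))) (*-congʳ (+-congˡ (sym (εsum-coefficients (g n)))))
    where
    remainder g : ℕ → Carrier
    remainder n = proj₁ (proj₂ (proj₂ (proj₂ (approx n))))
    -- Restriction also bounds the variables of the remainder, so the whole approximating family
    -- lives in polynomially many variables.
    g n = restrict (v n) (remainder n)
    formula : ∀ n → Σ[ φ ∈ Expr ℕ (Fracε 𝔽) ] (size φ ℕ.≤ closure-size (proj₁ (approx n)) (v n) ×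
      _≋_ 𝔽 (⟦_⟧ 𝔽 φ) (embedX 𝔽 (f n) + ε * g n , []))
    formula n with approx n
    ... | m , _ , ℓs , _ , eq = fibonacci⇒formula ℓs (v n) (f n) (proj₁ (h n)) _ m (proj₁ (proj₂ (h n))) (proj₂ (proj₂ (h n))) eq

theorem3p11 : ∀ {c ℓ} (𝔽 : Field c ℓ) →
    ¬ (Field._≈_ 𝔽 (Field._+_ 𝔽 (Field.1# 𝔽) (Field.1# 𝔽)) (Field.0# 𝔽)) →
    ∀ (f : ℕ-family 𝔽) → PolyManyVars 𝔽 f →
    ((InVPeClosure 𝔽 f → PolyBorderFib 𝔽 f) × (PolyBorderFib 𝔽 f → InVPeClosure 𝔽 f))
theorem3p11 𝔽 2≉0 f vars =
  ClosureToFibonacci.closure⇒fibonacci 𝔽 2≉0 f , FibonacciToClosure.fibonacci⇒closure 𝔽 f vars
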